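{- Let $P=((V,E),\langle V_1,V_R\rangle,\delta)$ be a Markov decision process with $n=|V|$ vertices, accessed only through set-based symbolic operations. For every $0<\epsilon\le 0.5$, the MEC decomposition of $P$ can be computed by a (deterministic) set-based symbolic algorithm using $O(n^{2-\epsilon}\log n)$ symbolic operations and symbolic space $O(n^{\epsilon}\log n)$.
   Context: A Markov decision process (MDP) $P=((V,E),\langle V_1,V_R\rangle,\delta)$ consists of a finite vertex set $V$ partitioned into player-1 vertices $V_1$ and random vertices $V_R$, an edge set $E\subseteq V\times V$, and a function $\delta$ assigning to each $v\in V_R$ a probability distribution over $V$ with $(v,w)\in E$ iff $\delta(v)[w]>0$ (w.l.o.g. uniform over the successors). It is assumed that there are no self-loops and every vertex has an outgoing edge. An end-component (EC) is a set $X\subseteq V$ such that the subgraph $(X,E\cap(X\times X))$ is strongly connected and for every $v\in X\cap V_R$ and every $(v,u)\in E$ we have $u\in X$; it is trivial if it is a single vertex with no edges, non-trivial otherwise. A maximal end-component (MEC) is an EC maximal under inclusion. The MEC decomposition is the partition of $V$ into the MECs and the set of vertices belonging to no MEC. In the set-based symbolic model, the algorithm may use ordinary RAM computation but accesses the MDP only via: basic set operations ($\cup,\cap,\subseteq,\setminus,\times,=$) on sets of vertices or edges; one-step operations $\mathrm{Pre}_E(S)=\{v\in V\mid \exists w\in S,(v,w)\in E\}$ and $\mathrm{Post}_E(S)=\{v\in V\mid \exists w\in S,(w,v)\in E\}$ (for any stored edge set); picking an arbitrary element of a set; and computing the cardinality of a set. The number of symbolic operations is the number of such operations performed; the symbolic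 space is the maximum number of sets (regardless of their size) stored simultaneously.
   Formalization: The exponent ε with 0 < ε ≤ 0.5 is taken to be a rational number p/q; irrational values of ε are not covered by the formal statement. -}

module Defs where

open import Data.Nat using (ℕ; zero; suc; _+_; _*_; _∸_; _^_; _≤_; _<_)
open import Data.Bool using (Bool; true; false; _∧_; _∨_; not)
open import Data.Fin using (Fin)
open import Data.Fin.Subset using (Subset; _∈_; _⊆_; ∣_∣; _∪_; _∩_; _─_; ⁅_⁆; ⊥; ∁; ⊤)
open import Data.Fin.Subset.Properties using (_⊆?_)
open import Data.Vec using (Vec; lookup; tabulate; zipWith; replicate; _[_]≔_; foldr)
open import Data.Vec.Properties using (≡-dec)
open import Data.List using (List; []; _∷_)
open import Data.List.Membership.Propositional using () renaming (_∈_ to _∈ˡ_)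
open import Data.List.Relation.Unary.All using (All)
open import Data.List.Relation.Unary.Unique.Propositional using (Unique)
open import Data.Maybe using (Maybe; just; nothing)
open import Data.Product using (_×_; _,_; ∃; Σ)
open import Relation.Binary.PropositionalEquality using (_≡_)
open import Relation.Nullary.Decidable using (⌊_⌋)
import Data.Bool.Properties as BoolP

VSet : ℕ → Set
VSet n = Subset n

ESet : ℕ → Set
ESet n = Vec (Subset n) n

_∈ᴱ_ : ∀ {n} → Fin n × Fin n → ESet n → Set
(u , w) ∈ᴱ F = lookup (lookup F u) w ≡ true

-- Markov decision processes (δ is uniform over successors, hence
-- determined by E and irrelevant for the MEC decomposition).

record MDP (n : ℕ) : Set where
  field
    V₁         : VSet n
    E          : ESet n
    noSelfLoop : ∀ v → lookup (lookup E v) v ≡ false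
    hasSucc    : ∀ v → ∃ λ w → (v , w) ∈ᴱ E

  Vᴿ : VSet n
  Vᴿ = ∁ V₁

open MDP public

data Reach {n} (M : MDP n) (X : VSet n) : Fin n → Fin n → Set where
  here  : ∀ {u} → u ∈ X → Reach M X u u
  step  : ∀ {u w v} → u ∈ X → (u , w) ∈ᴱ E M → Reach M X w v → Reach M X u v

record IsEC {n} (M : MDP n) (X : VSet n) : Set where
  field
    nonempty  : ∃ λ v → v ∈ X
    stronglyConnected : ∀ u v → u ∈ X → v ∈ X → Reach M X u v
    randomClosed : ∀ v w → v ∈ X → v ∈ Vᴿ M → (v , w) ∈ᴱ E M → w ∈ X

IsMEC : ∀ {n} → MDP n → VSet n → Set
IsMEC M X = IsEC M X × (∀ Y → IsEC M Y → X ⊆ Y → Y ≡ X)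

IsMECDecomposition : ∀ {n} → MDP n → List (VSet n) → Set
IsMECDecomposition M Xs =
  Unique Xs × All (IsMEC M) Xs × (∀ X → IsMEC M X → X ∈ˡ Xs)

-- Set-based symbolic algorithms.
-- A program has kv vertex-set registers and ke edge-set registers
-- (symbolic space = kv + ke).  Ordinary RAM computation is free and is
-- modelled by the (arbitrary) branching of the program tree on the
-- answers it receives.

data BinOp : Set where
  union inter diff : BinOp

data TestOp : Set where
  subsetTest eqTest : TestOp

data VConst : Set where
  cV cV₁ cVᴿ cEmpty : VConst

data EConst : Set where
  cE cEmptyE : EConst

data Prog (n kv ke : ℕ) : Set where
  halt   : Prog n kv ke
  emit   : Fin kv → Prog n kv ke → Prog n kv ke
  loadV  : VConst → Fin kv → Prog n kv ke → Prog n kv ke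
  loadE  : EConst → Fin ke → Prog n kv ke → Prog n kv ke
  vbin   : BinOp → Fin kv → Fin kv → Fin kv → Prog n kv ke → Prog n kv ke
  ebin   : BinOp → Fin ke → Fin ke → Fin ke → Prog n kv ke → Prog n kv ke
  vtest  : TestOp → Fin kv → Fin kv → (Bool → Prog n kv ke) → Prog n kv ke
  etest  : TestOp → Fin ke → Fin ke → (Bool → Prog n kv ke) → Prog n kv ke
  prod   : Fin kv → Fin kv → Fin ke → Prog n kv ke → Prog n kv ke
  pre    : Fin ke → Fin kv → Fin kv → Prog n kv ke → Prog n kv ke
  post   : Fin ke → Fin kv → Fin kv → Prog n kv ke → Prog n kv ke
  vpick  : Fin kv → Fin kv → (Maybe (Fin n) → Prog n kv ke) → Prog n kv ke
  epick  : Fin ke → Fin ke → (Maybe (Fin n × Fin n) → Prog n kv ke) → Prog n kv ke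
  vcard  : Fin kv → (ℕ → Prog n kv ke) → Prog n kv ke
  ecard  : Fin ke → (ℕ → Prog n kv ke) → Prog n kv ke

record Algorithm (n : ℕ) : Set where
  field
    kv ke : ℕ
    prog  : Prog n kv ke

space : ∀ {n} → Algorithm n → ℕ
space A = Algorithm.kv A + Algorithm.ke A

-- Resolution of "pick an arbitrary element": an adversarial chooser,
-- which may depend on the step number (hence on the whole history).
record Chooser (n : ℕ) : Set where
  field
    chooseV : ℕ → VSet n → Maybe (Fin n)
    chooseE : ℕ → ESet n → Maybe (Fin n × Fin n)

record ValidChooser {n} (ch : Chooser n) : Set where
  field
    vJust    : ∀ i S v → Chooser.chooseV ch i S ≡ just v → v ∈ S
    vNothing : ∀ i S → Chooser.chooseV ch i S ≡ nothing → S ≡ ⊥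
    eJust    : ∀ i F e → Chooser.chooseE ch i F ≡ just e → e ∈ᴱ F
    eNothing : ∀ i F → Chooser.chooseE ch i F ≡ nothing → F ≡ replicate n ⊥

module _ {n : ℕ} where

  binV : BinOp → VSet n → VSet n → VSet n
  binV union = _∪_
  binV inter = _∩_
  binV diff  = _─_

  binE : BinOp → ESet n → ESet n → ESet n
  binE o = zipWith (binV o)

  testV : TestOp → VSet n → VSet n → Bool
  testV subsetTest A B = ⌊ A ⊆? B ⌋
  testV eqTest     A B = ⌊ ≡-dec BoolP._≟_ A B ⌋

  _⊆ᴱ?_ : ESet n → ESet n → Bool
  F ⊆ᴱ? G = foldr _ _∧_ true (zipWith (λ a b → ⌊ a ⊆? b ⌋) F G)

  testE : TestOp → ESet n → ESet n → Bool
  testE subsetTest F G = F ⊆ᴱ? G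
  testE eqTest     F G = ⌊ ≡-dec (≡-dec BoolP._≟_) F G ⌋

  anyV : VSet n → Bool
  anyV = foldr _ _∨_ false

  prodE : VSet n → VSet n → ESet n
  prodE A B = tabulate λ u → tabulate λ w → lookup A u ∧ lookup B w

  preE : ESet n → VSet n → VSet n
  preE F S = tabulate λ v → anyV (lookup F v ∩ S)

  postE : ESet n → VSet n → VSet n
  postE F S = tabulate λ v → anyV (tabulate λ w → lookup (lookup F w) v ∧ lookup S w)

  cardE : ESet n → ℕ
  cardE F = foldr _ (λ r acc → ∣ r ∣ + acc) 0 F

  singletonE : Fin n × Fin n → ESet n
  singletonE (u , w) = prodE ⁅ u ⁆ ⁅ w ⁆

  constV : MDP n → VConst → VSet n
  constV M cV     = ⊤
  constV M cV₁    = V₁ M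
  constV M cVᴿ    = Vᴿ M
  constV M cEmpty = ⊥

  constE : MDP n → EConst → ESet n
  constE M cE      = E M
  constE M cEmptyE = replicate n ⊥

  record Result : Set where
    field
      ops     : ℕ
      outputs : List (VSet n)

  open Result public

  run : ∀ {kv ke} → Prog n kv ke → MDP n → Chooser n →
        Vec (VSet n) kv → Vec (ESet n) ke → ℕ → Result
  run halt M ch R Q i = record { ops = i ; outputs = [] }
  run (emit r p) M ch R Q i =
    let res = run p M ch R Q i in
    record { ops = ops res ; outputs = lookup R r ∷ outputs res }
  run (loadV c d p) M ch R Q i = run p M ch (R [ d ]≔ constV M c) Q i
  run (loadE c d p) M ch R Q i = run p M ch R (Q [ d ]≔ constE M c) i
  run (vbin o a b d p) M ch R Q i =
    run p M ch (R [ d ]≔ binV o (lookup R a) (lookup R b)) Q (suc i)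
  run (ebin o a b d p) M ch R Q i =
    run p M ch R (Q [ d ]≔ binE o (lookup Q a) (lookup Q b)) (suc i)
  run (vtest o a b k) M ch R Q i =
    run (k (testV o (lookup R a) (lookup R b))) M ch R Q (suc i)
  run (etest o a b k) M ch R Q i =
    run (k (testE o (lookup Q a) (lookup Q b))) M ch R Q (suc i)
  run (prod a b d p) M ch R Q i =
    run p M ch R (Q [ d ]≔ prodE (lookup R a) (lookup R b)) (suc i)
  run (pre f a d p) M ch R Q i =
    run p M ch (R [ d ]≔ preE (lookup Q f) (lookup R a)) Q (suc i)
  run (post f a d p) M ch R Q i =
    run p M ch (R [ d ]≔ postE (lookup Q f) (lookup R a)) Q (suc i)
  run (vpick a d k) M ch R Q i with Chooser.chooseV ch i (lookup R a)
  ... | just v  = run (k (just v)) M ch (R [ d ]≔ ⁅ v ⁆) Q (suc i)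
  ... | nothing = run (k nothing) M ch (R [ d ]≔ ⊥) Q (suc i)
  run (epick a d k) M ch R Q i with Chooser.chooseE ch i (lookup Q a)
  ... | just e  = run (k (just e)) M ch R (Q [ d ]≔ singletonE e) (suc i)
  ... | nothing = run (k nothing) M ch R (Q [ d ]≔ replicate n ⊥) (suc i)
  run (vcard a k) M ch R Q i = run (k ∣ lookup R a ∣) M ch R Q (suc i)
  run (ecard a k) M ch R Q i = run (k (cardE (lookup Q a))) M ch R Q (suc i)

  execute : Algorithm n → MDP n → Chooser n → Result
  execute A M ch =
    run (Algorithm.prog A) M ch (replicate (Algorithm.kv A) ⊥)
        (replicate (Algorithm.ke A) (replicate n ⊥)) 0

{-# OPTIONS --safe #-}
module Submission where

-- An edge set register holds a whole family of disjoint vertex sets, as the union of the squares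
-- X × X, so ten registers suffice for every ε and only the number of operations matters.  With
-- D ≈ √n, a separator S is removed on the fly: a block whose random vertices have no exits is
-- searched forwards and backwards from a vertex, stopping at the first layer that is D times
-- smaller than both what lies before and what lies after it.  Sizes grow (then shrink) by the
-- factor 1 + 1/D until then, so a search takes O(D log n) steps; a block exhausted in both
-- directions is an end-component, and |S| ≤ n log n / D in the end.
--
-- The vertices v of S are then put back one at a time, at O(n) operations each.  Contract the
-- end-components known so far and let G be the largest set that random vertices cannot leave and
-- in which every contracted vertex has a successor.  A bottom component of G avoiding v would be a
-- known end-component with an edge leaving it, so all of G reaches v, and what v reaches inside G
-- is the new end-component around v.

open import Defs
open import Data.Nat using (ℕ; _+_; _*_; _∸_; _^_; _≤_; _<_)
open import Data.Nat.Logarithm using (⌈log₂_⌉)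
open import Data.Product using (_×_; ∃)

open import Data.Bool as Bool using (Bool; true; false; _∧_; if_then_else_)
open import Data.Empty using (⊥-elim) renaming (⊥ to Absurd)
open import Data.Fin using (Fin; #_)
import Data.Fin.Properties as Finₚ
open import Data.Fin.Subset
  using (_∈_; _∉_; _⊆_; ∣_∣; _∪_; _∩_; _─_; ⁅_⁆; ⊥; ⊤; inside; outside)
open import Data.Fin.Subset.Properties
open import Data.List using (List; []; _∷_; _++_; map)
open import Data.List.Membership.Propositional using () renaming (_∈_ to _∈ˡ_)
open import Data.List.Membership.Propositional.Properties using (∈-∃++)
open import Data.List.Relation.Binary.Permutation.Propositional using (_↭_; ↭-sym; ↭⇒↭ₛ)
open import Data.List.Relation.Binary.Permutation.Propositional.Properties using (∈-resp-↭; shift; map⁺)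
import Data.List.Relation.Binary.Permutation.Setoid.Properties as Permₛ
open import Data.List.Relation.Unary.All as All using (All; []; _∷_)
open import Data.List.Relation.Unary.AllPairs using (AllPairs; []; _∷_)
open import Data.List.Relation.Unary.Any using (here; there)
open import Data.List.Relation.Unary.Unique.Propositional using (Unique)
open import Data.Maybe using (just; nothing; maybe′)
open import Data.Nat using (zero; suc; _≤?_; z≤n; s≤s; s≤s⁻¹; NonZero; >-nonZero; >-nonZero⁻¹)
open import Data.Nat.ListAction using (sum)
open import Data.Nat.ListAction.Properties using (sum-↭)
open import Data.Nat.Logarithm using (⌈log₂⌉-mono-≤)
import Data.Nat.Properties as ℕₚ
open import Data.Nat.Tactic.RingSolver using (solve-∀)
open import Data.Product using (_,_; ∃₂; proj₁; proj₂)
open import Data.Sum as Sum using (_⊎_; inj₁; inj₂; [_,_])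
open import Data.Unit using () renaming (⊤ to Unit; tt to unit)
open import Data.Vec using (Vec; []; _∷_; lookup; tabulate; replicate; _[_]≔_; here; there)
open import Data.Vec.Properties
  using (lookup∘tabulate; lookup-zipWith; lookup-replicate; lookup⇒[]=; []=⇒lookup)
open import Function using (_$_; const)
open import Relation.Nullary using (¬_; Dec; yes; no; _×-dec_)
open import Relation.Nullary.Decidable using (⌊_⌋)
open import Relation.Binary.PropositionalEquality
  using (_≡_; refl; sym; trans; cong; subst; setoid; resp₂)

-- Building the separator takes at most `2 * n` rounds of O(D log n) operations, and reinserting its
-- at most n log n / D vertices takes O(n) operations each. These balance at D ≈ √n, giving n^(3/2)
-- log n, which is within n^(2-ε) log n exactly because ε ≤ 1/2. The interface between the two
-- halves is `Covers S Q`: the classes of `Q` are the maximal ones among the end-components disjoint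
-- from `S`. At `S = ⊥` they are the maximal end-components.
--
-- Singletons need separate care. A single player-1 vertex is an end-component, but it has no
-- successor other than through edges leaving it, so the search for large components discards it; a
-- single random vertex never is one, since it has a successor other than itself.
--
-- Programs are finite trees, so every loop carries fuel. The number of operations is bounded along
-- all branches without any invariant; that the fuel never runs out too early is part of
-- correctness, where potentials such as block sizes and ball radii bound the rounds.

private variable
  n : ℕ

-- Vertex sets and edge sets

Disjoint : VSet n → VSet n → Set
Disjoint P Q = ∀ {x} → x ∈ P → x ∉ Q

Disjoint-sym : {P Q : VSet n} → Disjoint P Q → Disjoint Q P
Disjoint-sym d x∈Q x∈P = d x∈P x∈Q

∈─⁻ : {x : Fin n} (P Q : VSet n) → x ∈ P ─ Q → x ∈ P × x ∉ Q
∈─⁻ P Q x∈ = p─q⊆p P Q x∈ , go P Q x∈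
  where
  go : ∀ {n} {x : Fin n} (P Q : VSet n) → x ∈ P ─ Q → x ∉ Q
  go (_ ∷ P) (outside ∷ Q) (there x∈) (there x∈Q) = go P Q x∈ x∈Q
  go (_ ∷ P) (inside  ∷ Q) (there x∈) (there x∈Q) = go P Q x∈ x∈Q

∪⁺ˡ : {x : Fin n} {P : VSet n} (Q : VSet n) → x ∈ P → x ∈ P ∪ Q
∪⁺ˡ Q x∈P = x∈p∪q⁺ (inj₁ x∈P)

∪⁺ʳ : {x : Fin n} (P : VSet n) {Q : VSet n} → x ∈ Q → x ∈ P ∪ Q
∪⁺ʳ P x∈Q = x∈p∪q⁺ (inj₂ x∈Q)

∪-⊆ : {P Q R : VSet n} → P ⊆ R → Q ⊆ R → P ∪ Q ⊆ R
∪-⊆ {P = P} {Q} P⊆R Q⊆R x∈ = [ P⊆R , Q⊆R ] (x∈p∪q⁻ P Q x∈)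

∣∪∣≤ : (P Q : VSet n) → ∣ P ∪ Q ∣ ≤ ∣ P ∣ + ∣ Q ∣
∣∪∣≤ []            []            = z≤n
∣∪∣≤ (outside ∷ P) (outside ∷ Q) = ∣∪∣≤ P Q
∣∪∣≤ (outside ∷ P) (inside  ∷ Q) rewrite ℕₚ.+-suc ∣ P ∣ ∣ Q ∣ = s≤s (∣∪∣≤ P Q)
∣∪∣≤ (inside  ∷ P) (outside ∷ Q) = s≤s (∣∪∣≤ P Q)
∣∪∣≤ (inside  ∷ P) (inside  ∷ Q) rewrite ℕₚ.+-suc ∣ P ∣ ∣ Q ∣ =
  s≤s (ℕₚ.m≤n⇒m≤1+n (∣∪∣≤ P Q))

disjoint-∣∪∣ : (P Q : VSet n) → Disjoint P Q → ∣ P ∣ + ∣ Q ∣ ≡ ∣ P ∪ Q ∣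
disjoint-∣∪∣ []            []            d = refl
disjoint-∣∪∣ (outside ∷ P) (outside ∷ Q) d =
  disjoint-∣∪∣ P Q λ p q → d (there p) (there q)
disjoint-∣∪∣ (outside ∷ P) (inside  ∷ Q) d rewrite ℕₚ.+-suc ∣ P ∣ ∣ Q ∣ =
  cong suc (disjoint-∣∪∣ P Q λ p q → d (there p) (there q))
disjoint-∣∪∣ (inside  ∷ P) (outside ∷ Q) d =
  cong suc (disjoint-∣∪∣ P Q λ p q → d (there p) (there q))
disjoint-∣∪∣ (inside  ∷ P) (inside  ∷ Q) d = ⊥-elim (d here here)

disjoint-∣+∣≤ : {P Q R : VSet n} → Disjoint P Q → P ⊆ R → Q ⊆ R → ∣ P ∣ + ∣ Q ∣ ≤ ∣ R ∣
disjoint-∣+∣≤ {P = P} {Q} d P⊆R Q⊆R =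
  ℕₚ.≤-trans (ℕₚ.≤-reflexive (disjoint-∣∪∣ P Q d)) (p⊆q⇒∣p∣≤∣q∣ (∪-⊆ P⊆R Q⊆R))

∈⇒∣∣>0 : {x : Fin n} {P : VSet n} → x ∈ P → 0 < ∣ P ∣
∈⇒∣∣>0 {x = x} x∈P = subst (_≤ _) (∣⁅x⁆∣≡1 x)
  (p⊆q⇒∣p∣≤∣q∣ λ y∈ → subst (_∈ _) (sym (x∈⁅y⁆⇒x≡y x y∈)) x∈P)

⊈⇒∃ : (P Q : VSet n) → ¬ (P ⊆ Q) → ∃ λ x → x ∈ P × x ∉ Q
⊈⇒∃ P Q ¬sub with nonempty? (P ─ Q)
... | yes (x , x∈) = x , ∈─⁻ P Q x∈
... | no  empty    = ⊥-elim (¬sub λ {x} x∈P → inQ x x∈P)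
  where
  inQ : ∀ x → x ∈ P → x ∈ Q
  inQ x x∈P with x ∈? Q
  ... | yes x∈Q = x∈Q
  ... | no  x∉Q = ⊥-elim (empty (x , x∈p∧x∉q⇒x∈p─q x∈P x∉Q))

anyV⁺ : {x : Fin n} {P : VSet n} → x ∈ P → anyV P ≡ true
anyV⁺ {P = inside  ∷ P} here       = refl
anyV⁺ {P = inside  ∷ P} (there x∈) = refl
anyV⁺ {P = outside ∷ P} (there x∈) = anyV⁺ x∈

anyV⁻ : (P : VSet n) → anyV P ≡ true → ∃ λ x → x ∈ P
anyV⁻ (inside  ∷ P) eq = Fin.zero , here
anyV⁻ (outside ∷ P) eq with anyV⁻ P eq
... | x , x∈ = Fin.suc x , there x∈

∈-tabulate⁺ : {f : Fin n → Bool} {x : Fin n} → f x ≡ true → x ∈ tabulate f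
∈-tabulate⁺ {f = f} {x} eq = lookup⇒[]= x _ (trans (lookup∘tabulate f x) eq)

∈-tabulate⁻ : {f : Fin n → Bool} {x : Fin n} → x ∈ tabulate f → f x ≡ true
∈-tabulate⁻ {f = f} {x} x∈ = trans (sym (lookup∘tabulate f x)) ([]=⇒lookup x∈)

∧-true⁻ : {a b : Bool} → a ∧ b ≡ true → a ≡ true × b ≡ true
∧-true⁻ {true} {true} refl = refl , refl

∧-true⁺ : {a b : Bool} → a ≡ true → b ≡ true → a ∧ b ≡ true
∧-true⁺ refl refl = refl

row⁺ : (F : ESet n) {u w : Fin n} → (u , w) ∈ᴱ F → w ∈ lookup F u
row⁺ F {w = w} = lookup⇒[]= w _

row⁻ : (F : ESet n) {u w : Fin n} → w ∈ lookup F u → (u , w) ∈ᴱ F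
row⁻ F = []=⇒lookup

module _ (F : ESet n) (S : VSet n) where

  ∈pre⁺ : ∀ {v w} → (v , w) ∈ᴱ F → w ∈ S → v ∈ preE F S
  ∈pre⁺ vw w∈ = ∈-tabulate⁺ (anyV⁺ (x∈p∩q⁺ (row⁺ F vw , w∈)))

  ∈pre⁻ : ∀ {v} → v ∈ preE F S → ∃ λ w → (v , w) ∈ᴱ F × w ∈ S
  ∈pre⁻ {v} v∈ with anyV⁻ _ (∈-tabulate⁻ {f = λ v → anyV (lookup F v ∩ S)} v∈)
  ... | w , w∈ with x∈p∩q⁻ (lookup F v) S w∈
  ... | p , q = w , row⁻ F p , q

  ∈post⁺ : ∀ {v w} → (w , v) ∈ᴱ F → w ∈ S → v ∈ postE F S
  ∈post⁺ {v} wv w∈ = ∈-tabulate⁺ (anyV⁺ (∈-tabulate⁺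
    {f = λ w → lookup (lookup F w) v ∧ lookup S w} (∧-true⁺ wv ([]=⇒lookup w∈))))

  ∈post⁻ : ∀ {v} → v ∈ postE F S → ∃ λ w → (w , v) ∈ᴱ F × w ∈ S
  ∈post⁻ {v} v∈
    with anyV⁻ _ (∈-tabulate⁻ {f = λ v → anyV (tabulate λ w → lookup (lookup F w) v ∧ lookup S w)} v∈)
  ... | w , w∈ with ∧-true⁻ (∈-tabulate⁻ {f = λ w → lookup (lookup F w) v ∧ lookup S w} w∈)
  ... | p , q = w , p , lookup⇒[]= w S q

module _ (A B : VSet n) where

  lookup-prodE : ∀ u w → lookup (lookup (prodE A B) u) w ≡ lookup A u ∧ lookup B w
  lookup-prodE u w
    rewrite lookup∘tabulate (λ u → tabulate λ w → lookup A u ∧ lookup B w) u =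
    lookup∘tabulate (λ w → lookup A u ∧ lookup B w) w

  ∈prod⁺ : ∀ {u w} → u ∈ A → w ∈ B → (u , w) ∈ᴱ prodE A B
  ∈prod⁺ {u} {w} u∈ w∈ rewrite lookup-prodE u w | []=⇒lookup u∈ | []=⇒lookup w∈ = refl

  ∈prod⁻ : ∀ {u w} → (u , w) ∈ᴱ prodE A B → u ∈ A × w ∈ B
  ∈prod⁻ {u} {w} uw with ∧-true⁻ (trans (sym (lookup-prodE u w)) uw)
  ... | p , q = lookup⇒[]= u A p , lookup⇒[]= w B q

module _ (F G : ESet n) where

  ∈ᴱ∪⁺ : ∀ {u w} → (u , w) ∈ᴱ F ⊎ (u , w) ∈ᴱ G → (u , w) ∈ᴱ binE union F G
  ∈ᴱ∪⁺ {u} uw rewrite lookup-zipWith _∪_ u F G =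
    []=⇒lookup (x∈p∪q⁺ {p = lookup F u} {q = lookup G u} (Sum.map (row⁺ F) (row⁺ G) uw))

  ∈ᴱ∪⁻ : ∀ {u w} → (u , w) ∈ᴱ binE union F G → (u , w) ∈ᴱ F ⊎ (u , w) ∈ᴱ G
  ∈ᴱ∪⁻ {u} {w} uw rewrite lookup-zipWith _∪_ u F G
    with x∈p∪q⁻ (lookup F u) (lookup G u) (lookup⇒[]= w _ uw)
  ... | inj₁ p = inj₁ (row⁻ F p)
  ... | inj₂ p = inj₂ (row⁻ G p)

  ∈ᴱ─⁺ : ∀ {u w} → (u , w) ∈ᴱ F → ¬ (u , w) ∈ᴱ G → (u , w) ∈ᴱ binE diff F G
  ∈ᴱ─⁺ {u} p ¬q rewrite lookup-zipWith _─_ u F G =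
    []=⇒lookup (x∈p∧x∉q⇒x∈p─q (row⁺ F p) λ q → ¬q (row⁻ G q))

  ∈ᴱ─⁻ : ∀ {u w} → (u , w) ∈ᴱ binE diff F G → (u , w) ∈ᴱ F × ¬ (u , w) ∈ᴱ G
  ∈ᴱ─⁻ {u} {w} uw rewrite lookup-zipWith _─_ u F G
    with ∈─⁻ (lookup F u) (lookup G u) (lookup⇒[]= w _ uw)
  ... | p , ¬q = row⁻ F p , λ q → ¬q (row⁺ G q)

∉ᴱ∅ : {u w : Fin n} → ¬ (u , w) ∈ᴱ replicate n ⊥
∉ᴱ∅ {n} {u} {w} uw rewrite lookup-replicate u (⊥ {n}) | lookup-replicate w false with uw
... | ()

-- Reachability and end-components

data Dir : Set where
  forward backward : Dir

module Graph {n : ℕ} (M : MDP n) where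

  _⟶_ : Fin n → Fin n → Set
  x ⟶ y = (x , y) ∈ᴱ E M

  module _ {X : VSet n} where

    source∈ : ∀ {u v} → Reach M X u v → u ∈ X
    source∈ (here u∈)     = u∈
    source∈ (step u∈ _ _) = u∈

    target∈ : ∀ {u v} → Reach M X u v → v ∈ X
    target∈ (here u∈)    = u∈
    target∈ (step _ _ p) = target∈ p

    reach-trans : ∀ {u v w} → Reach M X u v → Reach M X v w → Reach M X u w
    reach-trans (here _)       q = q
    reach-trans (step u∈ uw p) q = step u∈ uw (reach-trans p q)

    reach-snoc : ∀ {u v w} → Reach M X u v → v ⟶ w → w ∈ X → Reach M X u w
    reach-snoc p vw w∈ = reach-trans p (step (target∈ p) vw (here w∈))

    reach-closed : {C : VSet n} → (∀ {x y} → x ∈ C → x ⟶ y → y ∈ X → y ∈ C) →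
                   ∀ {u v} → Reach M X u v → u ∈ C → Reach M C u v
    reach-closed cl (here _)      u∈C = here u∈C
    reach-closed cl (step _ uw p) u∈C = step u∈C uw (reach-closed cl p (cl u∈C uw (source∈ p)))

  reach-mono : ∀ {X Y u v} → X ⊆ Y → Reach M X u v → Reach M Y u v
  reach-mono X⊆Y (here u∈)      = here (X⊆Y u∈)
  reach-mono X⊆Y (step u∈ uw p) = step (X⊆Y u∈) uw (reach-mono X⊆Y p)

  Step : Dir → Fin n → Fin n → Set
  Step forward  x y = x ⟶ y
  Step backward x y = y ⟶ x

  Path : Dir → VSet n → Fin n → Fin n → Set
  Path forward  X r x = Reach M X r x
  Path backward X r x = Reach M X x r

  img : Dir → ESet n → VSet n → VSet n
  img forward  = postE
  img backward = preE

  path-refl : ∀ d {X r} → r ∈ X → Path d X r r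
  path-refl forward  = here
  path-refl backward = here

  path-snoc : ∀ d {X r x y} → Path d X r x → Step d x y → y ∈ X → Path d X r y
  path-snoc forward  p xy y∈ = reach-snoc p xy y∈
  path-snoc backward p yx y∈ = step y∈ yx p

  ∈img⁺ : ∀ d {S x y} → Step d x y → x ∈ S → y ∈ img d (E M) S
  ∈img⁺ forward  = ∈post⁺ (E M) _
  ∈img⁺ backward = ∈pre⁺ (E M) _

  ∈img⁻ : ∀ d {S y} → y ∈ img d (E M) S → ∃ λ x → Step d x y × x ∈ S
  ∈img⁻ forward  = ∈post⁻ (E M) _
  ∈img⁻ backward = ∈pre⁻ (E M) _

  -- Each round that is not yet a fixed point adds a vertex, so `f + ∣ B ∣` does not decrease and
  -- fuel above `n - ∣ B ∣` suffices. `next` need not be monotone.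
  inflate : (P : VSet n → Set) (next : VSet n → VSet n) →
            (∀ B → B ⊆ next B) → (∀ B → P B → P (next B)) →
            ∀ f B → P B → n < f + ∣ B ∣ → ∃ λ C → B ⊆ C × P C × next C ⊆ C
  inflate P next infl pres zero    B PB lt = ⊥-elim (ℕₚ.<⇒≱ lt (∣p∣≤n B))
  inflate P next infl pres (suc f) B PB lt with next B ⊆? B
  ... | yes sub  = B , ⊆-refl , PB , sub
  ... | no  ¬sub
    with inflate P next infl pres f (next B) (pres B PB)
           (ℕₚ.<-≤-trans lt (ℕₚ.≤-trans (ℕₚ.≤-reflexive (sym (ℕₚ.+-suc f ∣ B ∣)))
             (ℕₚ.+-monoʳ-≤ f (p⊂q⇒∣p∣<∣q∣ (infl B , ⊈⇒∃ _ _ ¬sub)))))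
  ... | C , nB⊆C , PC , fix = C , ⊆-trans (infl B) nB⊆C , PC , fix

  -- Turns reachability into a set, whose inclusions can be decided. It serves existence proofs
  -- only; the program runs its own searches.
  reachable : ∀ d X r → r ∈ X → ∃ λ C → r ∈ C × (∀ {x} → x ∈ C → Path d X r x) ×
              (∀ {x y} → x ∈ C → Step d x y → y ∈ X → y ∈ C)
  reachable d X r r∈X
    with inflate (λ B → ∀ {x} → x ∈ B → Path d X r x) (λ B → B ∪ (img d (E M) B ∩ X))
           (λ B → p⊆p∪q _)
           (λ B PB x∈ → [ PB , extend {B} PB ] (x∈p∪q⁻ B _ x∈))
           (suc n) ⁅ r ⁆
           (λ {x} x∈ → subst (Path d X r) (sym (x∈⁅y⁆⇒x≡y r x∈)) (path-refl d r∈X))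
           (s≤s (ℕₚ.m≤m+n n _))
    where
    extend : ∀ {B} → (∀ {x} → x ∈ B → Path d X r x) → ∀ {y} → y ∈ img d (E M) B ∩ X → Path d X r y
    extend {B} PB y∈ with x∈p∩q⁻ (img d (E M) B) X y∈
    ... | y∈img , y∈X with ∈img⁻ d y∈img
    ... | x , xy , x∈ = path-snoc d (PB x∈) xy y∈X
  ... | C , r⊆C , PC , fix =
    C , r⊆C (x∈⁅x⁆ r) , PC ,
    λ x∈ xy y∈X → fix (∪⁺ʳ C (x∈p∩q⁺ (∈img⁺ d xy x∈ , y∈X)))

  -- Once `Z` meets `C`, walks inside `Z` that start there can never leave `C`, and strong
  -- connectivity makes them reach all of `Z`. Hence one missing direction of edges is enough.
  ec-split : ∀ {Z C D} → IsEC M Z → (∀ {x} → x ∈ Z → x ∈ C ⊎ x ∈ D) → Disjoint C D →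
             (∀ {x y} → x ∈ C → y ∈ D → ¬ x ⟶ y) → Z ⊆ C ⊎ Z ⊆ D
  ec-split {Z} {C} {D} ec cov disj noEdge with nonempty? (Z ∩ C)
  ... | yes (z , z∈) = inj₁ λ x∈Z →
    target∈ (reach-closed closed (IsEC.stronglyConnected ec z _ z∈Z x∈Z) z∈C)
    where
    z∈Z = proj₁ (x∈p∩q⁻ Z C z∈)
    z∈C = proj₂ (x∈p∩q⁻ Z C z∈)
    closed : ∀ {x y} → x ∈ C → x ⟶ y → y ∈ Z → y ∈ C
    closed x∈C xy y∈Z = [ (λ y∈C → y∈C) , (λ y∈D → ⊥-elim (noEdge x∈C y∈D xy)) ] (cov y∈Z)
  ... | no  empty    = inj₂ λ x∈Z →
    [ (λ x∈C → ⊥-elim (empty (_ , x∈p∩q⁺ (x∈Z , x∈C)))) , (λ x∈D → x∈D) ] (cov x∈Z)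

  -- Induction on the size of a set closed inside `G`. If `x` does not reach all of `C`, what it
  -- reaches is a smaller closed set. If not all of `C` reaches `x`, the vertices that do not form
  -- one, as an edge from them into `B` would put its source into `B`. Otherwise `C` is strongly
  -- connected.
  bottom-ec : ∀ {G} → (∀ {x y} → x ∈ G → x ∈ Vᴿ M → x ⟶ y → y ∈ G) →
              ∀ k C → ∣ C ∣ < k → (∃ λ x → x ∈ C) → C ⊆ G →
              (∀ {x y} → x ∈ C → x ⟶ y → y ∈ G → y ∈ C) →
              ∃ λ Z → IsEC M Z × Z ⊆ C × (∀ {x y} → x ∈ Z → x ⟶ y → y ∈ G → y ∈ Z)
  bottom-ec {G} rc (suc k) C (s≤s lt) (x , x∈C) C⊆G closed
    with reachable forward C x x∈C | reachable backward C x x∈C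
  ... | F , x∈F , fromx , F-closed | B , x∈B , tox , B-closed with C ⊆? F | C ⊆? B
  ... | no C⊈F | _ with bottom-ec rc k F
          (ℕₚ.<-≤-trans (p⊂q⇒∣p∣<∣q∣ ((λ y∈ → target∈ (fromx y∈)) , ⊈⇒∃ C F C⊈F)) lt)
          (x , x∈F) (λ y∈ → C⊆G (target∈ (fromx y∈)))
          (λ y∈ yz z∈G → F-closed y∈ yz (closed (target∈ (fromx y∈)) yz z∈G))
  ... | Z , ec , Z⊆F , Z-closed = Z , ec , (λ y∈ → target∈ (fromx (Z⊆F y∈))) , Z-closed
  bottom-ec {G} rc (suc k) C (s≤s lt) (x , x∈C) C⊆G closed
      | F , x∈F , fromx , F-closed | B , x∈B , tox , B-closed | yes _ | no C⊈B
    with ⊈⇒∃ C B C⊈B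
  ... | y , y∈C , y∉B
    with bottom-ec rc k (C ─ B)
          (ℕₚ.<-≤-trans (p∩q≢∅⇒∣p─q∣<∣p∣ C B (x , x∈p∩q⁺ (x∈C , x∈B))) lt)
          (y , x∈p∧x∉q⇒x∈p─q y∈C y∉B) (λ z∈ → C⊆G (p─q⊆p C B z∈))
          (λ z∈ zw w∈G → let z∈C , z∉B = ∈─⁻ C B z∈ in
             x∈p∧x∉q⇒x∈p─q (closed z∈C zw w∈G) λ w∈B → z∉B (B-closed w∈B zw z∈C))
  ... | Z , ec , Z⊆ , Z-closed = Z , ec , (λ z∈ → p─q⊆p C B (Z⊆ z∈)) , Z-closed
  bottom-ec {G} rc (suc k) C (s≤s lt) (x , x∈C) C⊆G closed
      | F , x∈F , fromx , F-closed | B , x∈B , tox , B-closed | yes C⊆F | yes C⊆B =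
    C , record
      { nonempty = x , x∈C
      ; stronglyConnected = λ u v u∈ v∈ → reach-trans (tox (C⊆B u∈)) (fromx (C⊆F v∈))
      ; randomClosed = λ v w v∈ v∈R vw → closed v∈ vw (rc (C⊆G v∈) v∈R vw)
      } , ⊆-refl , closed

  -- A partial equivalence relation: the row of a vertex is its class, and an empty row marks a
  -- vertex in no known end-component.
  record Classes (Q : ESet n) : Set where
    field
      symQ   : ∀ {x y} → (x , y) ∈ᴱ Q → (y , x) ∈ᴱ Q
      transQ : ∀ {x y z} → (x , y) ∈ᴱ Q → (y , z) ∈ᴱ Q → (x , z) ∈ᴱ Q
      ecQ    : ∀ {x y} → (x , y) ∈ᴱ Q → IsEC M (lookup Q x)

    reflˡ : ∀ {x y} → (x , y) ∈ᴱ Q → (x , x) ∈ᴱ Q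
    reflˡ xy = transQ xy (symQ xy)

    reflʳ : ∀ {x y} → (x , y) ∈ᴱ Q → (y , y) ∈ᴱ Q
    reflʳ xy = transQ (symQ xy) xy

    connect : ∀ {G x y} → (∀ {u v} → u ∈ G → (u , v) ∈ᴱ Q → v ∈ G) → x ∈ G →
              (x , y) ∈ᴱ Q → Reach M G x y
    connect sat x∈G xy = reach-mono (λ z∈ → sat x∈G (row⁻ Q z∈))
      (IsEC.stronglyConnected (ecQ xy) _ _ (row⁺ Q (reflˡ xy)) (row⁺ Q xy))

  open Classes

  -- Saturation means that `B` swallows every old class it meets, so transitivity survives the
  -- union. `B` may be empty, whence the form of the second hypothesis.
  add-class : ∀ {Q B} → Classes Q → (∀ {x} → x ∈ B → IsEC M B) →
              (∀ {x y} → x ∈ B → (x , y) ∈ᴱ Q → y ∈ B) → Classes (binE union Q (prodE B B))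
  add-class {Q} {B} cl ecB sat = record
    { symQ   = λ xy → ∈ᴱ∪⁺ Q (prodE B B) ([ (λ p → inj₁ (symQ cl p)) , (λ p → inj₂ (flipB p)) ] (∈ᴱ∪⁻ Q (prodE B B) xy))
    ; transQ = λ xy yz → tr (∈ᴱ∪⁻ Q (prodE B B) xy) (∈ᴱ∪⁻ Q (prodE B B) yz)
    ; ecQ    = ec
    }
    where
    Q′ = binE union Q (prodE B B)
    flipB : ∀ {x y} → (x , y) ∈ᴱ prodE B B → (y , x) ∈ᴱ prodE B B
    flipB p = let x∈ , y∈ = ∈prod⁻ B B p in ∈prod⁺ B B y∈ x∈
    new : ∀ {x y} → x ∈ B → y ∈ B → (x , y) ∈ᴱ Q′
    new x∈ y∈ = ∈ᴱ∪⁺ Q (prodE B B) (inj₂ (∈prod⁺ B B x∈ y∈))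
    tr : ∀ {x y z} → (x , y) ∈ᴱ Q ⊎ (x , y) ∈ᴱ prodE B B →
         (y , z) ∈ᴱ Q ⊎ (y , z) ∈ᴱ prodE B B → (x , z) ∈ᴱ Q′
    tr (inj₁ p) (inj₁ q) = ∈ᴱ∪⁺ Q (prodE B B) (inj₁ (transQ cl p q))
    tr (inj₁ p) (inj₂ q) = let y∈ , z∈ = ∈prod⁻ B B q in new (sat y∈ (symQ cl p)) z∈
    tr (inj₂ p) (inj₁ q) = let x∈ , y∈ = ∈prod⁻ B B p in new x∈ (sat y∈ q)
    tr (inj₂ p) (inj₂ q) = new (proj₁ (∈prod⁻ B B p)) (proj₂ (∈prod⁻ B B q))
    ec : ∀ {x y} → (x , y) ∈ᴱ Q′ → IsEC M (lookup Q′ x)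
    ec {x} {y} xy with x ∈? B
    ... | yes x∈B = subst (IsEC M) (⊆-antisym
            (λ z∈ → row⁺ Q′ (new x∈B z∈))
            (λ z∈ → [ sat x∈B , (λ p → proj₂ (∈prod⁻ B B p)) ] (∈ᴱ∪⁻ Q (prodE B B) (row⁻ Q′ z∈)))) (ecB x∈B)
    ... | no  x∉B = subst (IsEC M) (⊆-antisym
            (λ z∈ → row⁺ Q′ (∈ᴱ∪⁺ Q (prodE B B) (inj₁ (row⁻ Q z∈))))
            (λ z∈ → row⁺ Q (old (∈ᴱ∪⁻ Q (prodE B B) (row⁻ Q′ z∈))))) (ecQ cl (old (∈ᴱ∪⁻ Q (prodE B B) xy)))
      where
      old : ∀ {z} → (x , z) ∈ᴱ Q ⊎ (x , z) ∈ᴱ prodE B B → (x , z) ∈ᴱ Q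
      old (inj₁ p) = p
      old (inj₂ p) = ⊥-elim (x∉B (proj₁ (∈prod⁻ B B p)))

  -- `covers` puts each end-component avoiding `S` inside one class, while the classes are
  -- themselves such end-components; so `S` determines `Q`.
  record Covers (S : VSet n) (Q : ESet n) : Set where
    field
      classes : Classes Q
      avoids  : ∀ {x y} → (x , y) ∈ᴱ Q → x ∉ S
      covers  : ∀ {Z} → IsEC M Z → Disjoint Z S → ∀ {x y} → x ∈ Z → y ∈ Z → (x , y) ∈ᴱ Q

  open Covers

  -- The invariant of the descent to the greatest stable `G`. In `large` the witness `z` excludes
  -- the trivial component consisting of `v` alone, which has no inner edge and would be pruned.
  record Candidate (S : VSet n) (v : Fin n) (Q : ESet n) (G : VSet n) : Set where
    field
      avoidsS   : Disjoint G S
      saturated : ∀ {x y} → x ∈ G → (x , y) ∈ᴱ Q → y ∈ G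
      large     : ∀ {Z z} → IsEC M Z → Disjoint Z S → v ∈ Z → z ∈ Z → z ∉ ⁅ v ⁆ → Z ⊆ G

  open Candidate

  -- Deleting Q from the edges amounts to contracting the known classes.
  escapes : ESet n → VSet n → VSet n
  escapes Q G = preE (binE diff (E M) Q) G ∩ G

  exits : VSet n → VSet n
  exits G = preE (E M) (⊤ ─ G) ∩ Vᴿ M

  -- One vertex of a class with an edge out of the class saves the whole class, hence `postE Q`; an
  -- unclassified vertex has to be in `escapes` itself. Random exits are then deleted vertex by
  -- vertex.
  refine : ESet n → VSet n → VSet n
  refine Q G = (escapes Q G ∪ postE Q (escapes Q G)) ─ exits G

  module _ {S : VSet n} {v : Fin n} {Q : ESet n} {G : VSet n} where

    ∈escapes⁺ : ∀ {x y} → x ∈ G → x ⟶ y → y ∈ G → ¬ (x , y) ∈ᴱ Q → x ∈ escapes Q G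
    ∈escapes⁺ x∈G xy y∈G ¬Q = x∈p∩q⁺ (∈pre⁺ (binE diff (E M) Q) G (∈ᴱ─⁺ (E M) Q xy ¬Q) y∈G , x∈G)

    -- Classes survive or vanish as a whole. Every vertex of a large component `Z` has a walk inside
    -- `Z` to another contracted vertex, and the first edge leaving its own one keeps it in the set.
    refine-candidate : Classes Q → (∀ {x y} → (x , y) ∈ᴱ Q → x ≡ v → Absurd) →
                       Candidate S v Q G → Candidate S v Q (G ∩ refine Q G)
    refine-candidate cl v∉Q cand = record
      { avoidsS   = λ x∈ → avoidsS cand (p∩q⊆p G _ x∈)
      ; saturated = sat
      ; large     = lrg
      }
      where
      P = escapes Q G
      sat : ∀ {x y} → x ∈ G ∩ refine Q G → (x , y) ∈ᴱ Q → y ∈ G ∩ refine Q G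
      sat {x} {y} x∈ xy with x∈p∩q⁻ G _ x∈
      ... | x∈G , x∈ref = x∈p∩q⁺ (y∈G , x∈p∧x∉q⇒x∈p─q y∈P′ y∉exit)
        where
        y∈G = saturated cand x∈G xy
        y∈P′ : y ∈ P ∪ postE Q P
        y∈P′ with x∈p∪q⁻ P _ (proj₁ (∈─⁻ _ _ x∈ref))
        ... | inj₁ x∈P  = ∪⁺ʳ P (∈post⁺ Q P xy x∈P)
        ... | inj₂ x∈Q  with ∈post⁻ Q P x∈Q
        ... | z , zx , z∈P = ∪⁺ʳ P (∈post⁺ Q P (transQ cl zx xy) z∈P)
        -- Deleting exits cannot tear a class apart: successors of its random vertices stay in the
        -- class, which lies in `G`.
        y∉exit : y ∉ exits G
        y∉exit y∈ with x∈p∩q⁻ (preE (E M) (⊤ ─ G)) (Vᴿ M) y∈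
        ... | y∈pre , y∈R with ∈pre⁻ (E M) (⊤ ─ G) y∈pre
        ... | w , yw , w∈ = proj₂ (∈─⁻ ⊤ G w∈) (saturated cand y∈G (row⁻ Q
                (IsEC.randomClosed (ecQ cl (reflʳ cl xy)) y w (row⁺ Q (reflʳ cl xy)) y∈R yw)))
      lrg : ∀ {Z z} → IsEC M Z → Disjoint Z S → v ∈ Z → z ∈ Z → z ∉ ⁅ v ⁆ → Z ⊆ G ∩ refine Q G
      lrg {Z} {z} ec dis v∈Z z∈Z z≢v {x} x∈Z =
        x∈p∩q⁺ (Z⊆G x∈Z , x∈p∧x∉q⇒x∈p─q x∈P′ x∉exit)
        where
        Z⊆G : Z ⊆ G
        Z⊆G = large cand ec dis v∈Z z∈Z z≢v
        x∉exit : x ∉ exits G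
        x∉exit x∈ with x∈p∩q⁻ (preE (E M) (⊤ ─ G)) (Vᴿ M) x∈
        ... | x∈pre , x∈R with ∈pre⁻ (E M) (⊤ ─ G) x∈pre
        ... | w , xw , w∈ = proj₂ (∈─⁻ ⊤ G w∈) (Z⊆G (IsEC.randomClosed ec x w x∈Z x∈R xw))
        -- Follows a walk to `v` as long as it stays in the class of `x`. As `v` is unclassified,
        -- the walk must leave at some edge, whose source `u` then carries `x` along.
        leaves : ∀ {u w} → (x , u) ∈ᴱ Q → Reach M Z u w → w ≡ v → x ∈ P ∪ postE Q P
        leaves xu (here u∈) refl = ⊥-elim (v∉Q (reflʳ cl xu) refl)
        leaves xu (step {w = w} u∈ uw p) eq with lookup (lookup Q x) w Bool.≟ true
        ... | yes xw = leaves xw p eq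
        ... | no ¬xw = ∪⁺ʳ P (∈post⁺ Q P (symQ cl xu)
                (∈escapes⁺ (Z⊆G u∈) uw (Z⊆G (source∈ p)) λ q → ¬xw (transQ cl xu q)))
        x∈P′ : x ∈ P ∪ postE Q P
        x∈P′ with lookup (lookup Q x) x Bool.≟ true
        ... | yes xx = leaves xx (IsEC.stronglyConnected ec x v x∈Z v∈Z) refl
        ... | no ¬xx = ∪⁺ˡ (postE Q P) (first (target x∈Z))
          where
          -- An unclassified `x` needs a walk of at least one edge; when `x` is `v` itself, the
          -- extra vertex `z` supplies it.
          target : x ∈ Z → ∃ λ t → Reach M Z x t × ¬ t ≡ x
          target _ with x Finₚ.≟ v
          ... | yes refl = z , IsEC.stronglyConnected ec x z x∈Z z∈Z , λ { refl → z≢v (x∈⁅x⁆ z) }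
          ... | no  x≢v  = v , IsEC.stronglyConnected ec x v x∈Z v∈Z , λ eq → x≢v (sym eq)
          first : (∃ λ t → Reach M Z x t × ¬ t ≡ x) → x ∈ P
          first (t , here _ , t≢x)       = ⊥-elim (t≢x refl)
          first (t , step _ xw p , t≢x) =
            ∈escapes⁺ (Z⊆G x∈Z) xw (Z⊆G (source∈ p)) λ q → ¬xx (reflˡ cl q)

-- Inserting a separator vertex

module Insert {n : ℕ} (M : MDP n) where
  open Graph M
  open Classes
  open Covers
  open Candidate

  module _ {S Q v} (cov : Covers S Q) (v∈S : v ∈ S) where

    v∉Q : ∀ {x y} → (x , y) ∈ᴱ Q → x ≡ v → Absurd
    v∉Q vy refl = avoids cov vy v∈S

    initial-candidate : Candidate (S ─ ⁅ v ⁆) v Q (⊤ ─ (S ─ ⁅ v ⁆))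
    initial-candidate = record
      { avoidsS   = λ x∈ → proj₂ (∈─⁻ ⊤ _ x∈)
      ; saturated = λ x∈ xy → x∈p∧x∉q⇒x∈p─q ∈⊤
          λ y∈ → avoids cov (symQ (classes cov) xy) (p─q⊆p S _ y∈)
      ; large     = λ _ dis _ _ _ x∈Z → x∈p∧x∉q⇒x∈p─q ∈⊤ (dis x∈Z)
      }

    -- `B` is what `v` reaches inside the stable `G`. It is empty if `v` itself was pruned, which is
    -- why `v ∈ G` appears as a condition.
    module _ {G B} (cand : Candidate (S ─ ⁅ v ⁆) v Q G) (stable : G ⊆ refine Q G)
             (v∈B : v ∈ G → v ∈ B) (fromv : ∀ {x} → x ∈ B → v ∈ G × Reach M G v x)
             (B-closed : ∀ {x y} → x ∈ B → x ⟶ y → y ∈ G → y ∈ B) where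

      private
        cl : Classes Q
        cl = classes cov

        rc : ∀ {x y} → x ∈ G → x ∈ Vᴿ M → x ⟶ y → y ∈ G
        rc {x} {y} x∈G x∈R xy with y ∈? G
        ... | yes y∈G = y∈G
        ... | no  y∉G = ⊥-elim (proj₂ (∈─⁻ _ (exits G) (stable x∈G))
                (x∈p∩q⁺ (∈pre⁺ (E M) (⊤ ─ G) xy (x∈p∧x∉q⇒x∈p─q ∈⊤ y∉G) , x∈R)))

        avoids-v : ∀ {C} → C ⊆ G → v ∉ C → Disjoint C S
        avoids-v C⊆G v∉C x∈C x∈S = avoidsS cand (C⊆G x∈C)
          (x∈p∧x∉q⇒x∈p─q x∈S λ x∈v → v∉C (subst (_∈ _) (x∈⁅y⁆⇒x≡y v x∈v) x∈C))

        no-trap : ∀ C → C ⊆ G → v ∉ C → (∀ {x y} → x ∈ C → x ⟶ y → y ∈ G → y ∈ C) →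
                  ∀ {x} → x ∉ C
        no-trap C C⊆G v∉C C-closed x∈C
          with bottom-ec rc (suc ∣ C ∣) C ℕₚ.≤-refl (_ , x∈C) C⊆G C-closed
        ... | Z , ec , Z⊆C , Z-closed with IsEC.nonempty ec
        ... | z , z∈Z = trap (x∈p∪q⁻ (escapes Q G) _ (proj₁ (∈─⁻ _ (exits G) (stable (C⊆G (Z⊆C z∈Z))))))
          where
          ZQ : ∀ {x y} → x ∈ Z → y ∈ Z → (x , y) ∈ᴱ Q
          ZQ = covers cov ec (λ x∈ → avoids-v C⊆G v∉C (Z⊆C x∈))
          leave : ∀ {y} → y ∈ Z → y ∉ escapes Q G
          leave y∈Z y∈ with x∈p∩q⁻ (preE (binE diff (E M) Q) G) G y∈
          ... | y∈pre , _ with ∈pre⁻ (binE diff (E M) Q) G y∈pre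
          ... | w , yw , w∈G with ∈ᴱ─⁻ (E M) Q yw
          ... | edge , ¬Q = ¬Q (ZQ y∈Z (Z-closed y∈Z edge w∈G))
          trap : z ∈ escapes Q G ⊎ z ∈ postE Q (escapes Q G) → Absurd
          trap (inj₁ z∈) = leave z∈Z z∈
          trap (inj₂ z∈) with ∈post⁻ Q (escapes Q G) z∈
          -- The class of `z` is connected inside `G` and `Z` is closed there, so the escaping
          -- member `y` of that class already lies in `Z`.
          ... | y , yz , y∈ = leave (target∈ (reach-closed Z-closed
                  (connect cl (saturated cand) (C⊆G (Z⊆C z∈Z)) (symQ cl yz)) z∈Z)) y∈

        to-v : ∀ {x} → x ∈ G → v ∈ G → Reach M G x v
        to-v {x} x∈G v∈G with reachable backward G v v∈G
        ... | N , v∈N , tov , N-closed with x ∈? N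
        ... | yes x∈N = tov x∈N
        ... | no  x∉N = ⊥-elim (no-trap (G ─ N) (p─q⊆p G N) (λ v∈ → proj₂ (∈─⁻ G N v∈) v∈N)
                (λ y∈ yz z∈G → x∈p∧x∉q⇒x∈p─q z∈G
                   λ z∈N → proj₂ (∈─⁻ G N y∈) (N-closed z∈N yz (p─q⊆p G N y∈)))
                (x∈p∧x∉q⇒x∈p─q x∈G x∉N))

        -- The trivial component of `v`, present only when `v` belongs to player 1. It matters when
        -- `v` has been pruned from `G` and is contained in `B` otherwise.
        v-V₁ : VSet n
        v-V₁ = V₁ M ∩ ⁅ v ⁆

        C : VSet n
        C = B ∪ v-V₁

        ∈v-V₁⁻ : ∀ {x} → x ∈ v-V₁ → x ≡ v × v ∈ V₁ M
        ∈v-V₁⁻ x∈ with x∈p∩q⁻ (V₁ M) ⁅ v ⁆ x∈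
        ... | x∈V₁ , x∈v with x∈⁅y⁆⇒x≡y v x∈v
        ... | refl = refl , x∈V₁

        ec-B : v ∈ G → IsEC M B
        ec-B v∈G = record
          { nonempty = v , v∈B v∈G
          ; stronglyConnected = λ x y x∈ y∈ → reach-closed B-closed
              (reach-trans (to-v (target∈ (proj₂ (fromv x∈))) v∈G) (proj₂ (fromv y∈))) x∈
          ; randomClosed = λ x y x∈ x∈R xy → B-closed x∈ xy (rc (target∈ (proj₂ (fromv x∈))) x∈R xy)
          }

        ec-C : ∀ {x} → x ∈ C → IsEC M C
        ec-C x∈C with v ∈? G
        ... | yes v∈G = subst (IsEC M) (⊆-antisym (p⊆p∪q _)
                (∪-⊆ ⊆-refl λ y∈ → subst (_∈ B) (sym (proj₁ (∈v-V₁⁻ y∈))) (v∈B v∈G))) (ec-B v∈G)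
        ... | no  v∉G with x∈p∪q⁻ B v-V₁ x∈C
        ... | inj₁ x∈B = ⊥-elim (v∉G (proj₁ (fromv x∈B)))
        ... | inj₂ x∈v = record
          { nonempty = _ , x∈C
          ; stronglyConnected = λ y z y∈ z∈ → subst (Reach M C y) (trans (only y∈) (sym (only z∈))) (here y∈)
          ; randomClosed = λ y z y∈ y∈R _ → ⊥-elim
              (x∈∁p⇒x∉p (subst (_∈ Vᴿ M) (only y∈) y∈R) (proj₂ (∈v-V₁⁻ x∈v)))
          }
          where
          only : ∀ {y} → y ∈ C → y ≡ v
          only y∈ = [ (λ y∈B → ⊥-elim (v∉G (proj₁ (fromv y∈B)))) , (λ y∈v → proj₁ (∈v-V₁⁻ y∈v)) ]
                      (x∈p∪q⁻ B v-V₁ y∈)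

        sat-C : ∀ {x y} → x ∈ C → (x , y) ∈ᴱ Q → y ∈ C
        sat-C x∈C xy with x∈p∪q⁻ B v-V₁ x∈C
        ... | inj₁ x∈B = ∪⁺ˡ v-V₁ (target∈ (reach-closed B-closed
                (connect cl (saturated cand) (target∈ (proj₂ (fromv x∈B))) xy) x∈B))
        ... | inj₂ x∈v = ⊥-elim (v∉Q xy (proj₁ (∈v-V₁⁻ x∈v)))

        C-avoids : Disjoint C (S ─ ⁅ v ⁆)
        C-avoids x∈C x∈S with x∈p∪q⁻ B v-V₁ x∈C
        ... | inj₁ x∈B = avoidsS cand (target∈ (proj₂ (fromv x∈B))) x∈S
        ... | inj₂ x∈v = proj₂ (∈─⁻ S ⁅ v ⁆ x∈S)
                (subst (_∈ ⁅ v ⁆) (sym (proj₁ (∈v-V₁⁻ x∈v))) (x∈⁅x⁆ v))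

        contains : ∀ {Z} → IsEC M Z → Disjoint Z (S ─ ⁅ v ⁆) → v ∈ Z → Z ⊆ C
        contains {Z} ec dis v∈Z {z} z∈Z with Z ⊆? ⁅ v ⁆
        ... | no Z⊈v with ⊈⇒∃ Z ⁅ v ⁆ Z⊈v
        ... | w , w∈Z , w∉v = ∪⁺ˡ v-V₁ (target∈ (reach-closed B-closed
                (reach-mono Z⊆G (IsEC.stronglyConnected ec v z v∈Z z∈Z)) (v∈B (Z⊆G v∈Z))))
          where
          Z⊆G : Z ⊆ G
          Z⊆G = large cand ec dis v∈Z w∈Z w∉v
        contains {Z} ec dis v∈Z {z} z∈Z | yes Z⊆v with v ∈? V₁ M
        ... | yes v∈V₁ = ∪⁺ʳ B (x∈p∩q⁺ (subst (_∈ V₁ M) (sym (x∈⁅y⁆⇒x≡y v (Z⊆v z∈Z))) v∈V₁ , Z⊆v z∈Z))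
        -- If `v` is random, its successor has to stay in the singleton and would be a self-loop.
        ... | no  v∉V₁ with hasSucc M v
        ... | w , vw with x∈⁅y⁆⇒x≡y v (Z⊆v (IsEC.randomClosed ec v w v∈Z (x∉p⇒x∈∁p v∉V₁) vw))
        ... | refl with trans (sym vw) (noSelfLoop M v)
        ... | ()

      -- A component that avoids the remaining separator either avoids `v` too and was covered
      -- before, or contains `v` and lies in the new class.
      insert-covers : Covers (S ─ ⁅ v ⁆) (binE union Q (prodE (B ∪ (V₁ M ∩ ⁅ v ⁆)) (B ∪ (V₁ M ∩ ⁅ v ⁆))))
      insert-covers = record
        { classes = add-class cl ec-C sat-C
        ; avoids  = λ xy x∈S → [ (λ p → avoids cov p (p─q⊆p S _ x∈S))
                               , (λ p → C-avoids (proj₁ (∈prod⁻ C C p)) x∈S) ] (∈ᴱ∪⁻ Q (prodE C C) xy)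
        ; covers  = cvr
        }
        where
        cvr : ∀ {Z} → IsEC M Z → Disjoint Z (S ─ ⁅ v ⁆) → ∀ {x y} → x ∈ Z → y ∈ Z →
              (x , y) ∈ᴱ binE union Q (prodE C C)
        cvr {Z} ec dis x∈ y∈ with v ∈? Z
        ... | yes v∈Z = ∈ᴱ∪⁺ Q (prodE C C)
                (inj₂ (∈prod⁺ C C (contains ec dis v∈Z x∈) (contains ec dis v∈Z y∈)))
        ... | no  v∉Z = ∈ᴱ∪⁺ Q (prodE C C) (inj₁ (covers cov ec
                (λ z∈Z z∈S → dis z∈Z (x∈p∧x∉q⇒x∈p─q z∈S
                   λ z∈v → v∉Z (subst (_∈ Z) (x∈⁅y⁆⇒x≡y v z∈v) z∈Z))) x∈ y∈))

  -- Reading the decomposition off the rows of `Q`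

  IsClass : ESet n → VSet n → Set
  IsClass Q X = ∃ λ x → (x , x) ∈ᴱ Q × X ≡ lookup Q x

  ListsClasses : ESet n → List (VSet n) → Set
  ListsClasses Q Xs = Unique Xs × All (IsClass Q) Xs × (∀ X → IsClass Q X → X ∈ˡ Xs)

  class-mec : ∀ {Q X} → Covers ⊥ Q → IsClass Q X → IsMEC M X
  class-mec {Q} cov (x , xx , refl) =
    ecQ (classes cov) xx ,
    λ Y ec X⊆Y → ⊆-antisym
      (λ y∈Y → row⁺ Q (covers cov ec (λ _ → ∉⊥) (X⊆Y (row⁺ Q xx)) y∈Y)) X⊆Y

  mec-class : ∀ {Q X} → Covers ⊥ Q → IsMEC M X → IsClass Q X
  mec-class {Q} cov (ec , maximal) with IsEC.nonempty ec
  ... | x , x∈X = x , xx , sym (maximal (lookup Q x) (ecQ (classes cov) xx)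
          λ y∈X → row⁺ Q (covers cov ec (λ _ → ∉⊥) x∈X y∈X))
    where
    xx : (x , x) ∈ᴱ Q
    xx = covers cov ec (λ _ → ∉⊥) x∈X x∈X

  lists-classes⇒decomposition : ∀ {Q Xs} → Covers ⊥ Q → ListsClasses Q Xs → IsMECDecomposition M Xs
  lists-classes⇒decomposition cov (unique , sound , complete) =
    unique , All.map (class-mec cov) sound , λ X mec → complete X (mec-class cov mec)

  module _ {Q : ESet n} (cl : Classes Q) {x : Fin n} (xx : (x , x) ∈ᴱ Q) where

    private
      X  = lookup Q x
      Q′ = binE diff Q (prodE X X)

    ∈remove⁺ : ∀ {y z} → (y , z) ∈ᴱ Q → y ∉ X → (y , z) ∈ᴱ Q′
    ∈remove⁺ yz y∉X = ∈ᴱ─⁺ Q (prodE X X) yz λ p → y∉X (proj₁ (∈prod⁻ X X p))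

    ∈remove⁻ : ∀ {y z} → (y , z) ∈ᴱ Q′ → (y , z) ∈ᴱ Q × y ∉ X
    ∈remove⁻ yz with ∈ᴱ─⁻ Q (prodE X X) yz
    ... | p , ¬XX = p , λ y∈X → ¬XX (∈prod⁺ X X y∈X (row⁺ Q (transQ cl (row⁻ Q y∈X) p)))

    row-remove : ∀ {y} → y ∉ X → lookup Q′ y ≡ lookup Q y
    row-remove y∉X = ⊆-antisym (λ z∈ → row⁺ Q (proj₁ (∈remove⁻ (row⁻ Q′ z∈))))
                               (λ z∈ → row⁺ Q′ (∈remove⁺ (row⁻ Q z∈) y∉X))

    remove-classes : Classes Q′
    remove-classes = record
      { symQ   = λ yz → let p , y∉X = ∈remove⁻ yz in
                   ∈remove⁺ (symQ cl p) λ z∈X → y∉X (row⁺ Q (transQ cl (row⁻ Q z∈X) (symQ cl p)))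
      ; transQ = λ yz zw → let p , y∉X = ∈remove⁻ yz in
                   ∈remove⁺ (transQ cl p (proj₁ (∈remove⁻ zw))) y∉X
      ; ecQ    = λ yz → let p , y∉X = ∈remove⁻ yz in subst (IsEC M) (sym (row-remove y∉X)) (ecQ cl p)
      }

    -- Deleting the square of one class leaves the rows of all other classes unchanged and empties
    -- its own, so later classes are old classes different from `X`.
    lists-cons : ∀ {Xs} → ListsClasses Q′ Xs → ListsClasses Q (X ∷ Xs)
    lists-cons (unique , sound , complete) =
      All.map (λ { (y , yy , refl) eq → let p , y∉X = ∈remove⁻ yy in
                     y∉X (subst (y ∈_) (sym (trans eq (row-remove y∉X))) (row⁺ Q p)) }) sound ∷ unique ,
      (x , xx , refl) ∷ All.map (λ { (y , yy , refl) → let p , y∉X = ∈remove⁻ yy in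
                     y , p , row-remove y∉X }) sound ,
      λ { Y (y , yy , refl) → cmp y yy }
      where
      cmp : ∀ y → (y , y) ∈ᴱ Q → lookup Q y ∈ˡ X ∷ _
      cmp y yy with y ∈? X
      ... | yes y∈X = here (⊆-antisym
              (λ z∈ → row⁺ Q (transQ cl (row⁻ Q y∈X) (row⁻ Q z∈)))
              (λ z∈ → row⁺ Q (transQ cl (symQ cl (row⁻ Q y∈X)) (row⁻ Q z∈))))
      ... | no  y∉X = there (complete _ (y , ∈remove⁺ yy y∉X , sym (row-remove y∉X)))

  lists-nil : ∀ {Q} → (∀ {x y} → ¬ (x , y) ∈ᴱ Q) → ListsClasses Q []
  lists-nil empty = [] , [] , λ { X (x , xx , _) → ⊥-elim (empty xx) }

-- Potentials and the growth of balls

module Arithmetic where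
  open import Data.Nat
  open import Data.Nat.DivMod using (m<n*o⇒m/o<n; /-monoˡ-≤; m≡m%n+[m/n]*n; m%n<n)
  open import Data.Nat.Induction using (<-rec)
  open import Data.Nat.Logarithm
  open import Data.Nat.Properties
  open import Relation.Binary.PropositionalEquality using (cong₂)

  n≤2^⌈log₂n⌉ : ∀ n → n ≤ 2 ^ ⌈log₂ n ⌉
  n≤2^⌈log₂n⌉ = <-rec _ go
    where
    go : ∀ n → (∀ {m} → m < n → m ≤ 2 ^ ⌈log₂ m ⌉) → n ≤ 2 ^ ⌈log₂ n ⌉
    go 0 _ = z≤n
    go 1 _ = ≤-refl
    go n@(suc (suc k)) rec = begin
      n                                  ≡⟨ ⌊n/2⌋+⌈n/2⌉≡n n ⟨
      ⌊ n /2⌋ + ⌈ n /2⌉                  ≤⟨ +-monoˡ-≤ ⌈ n /2⌉ (⌊n/2⌋≤⌈n/2⌉ n) ⟩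
      ⌈ n /2⌉ + ⌈ n /2⌉                  ≡⟨ cong (⌈ n /2⌉ +_) (+-identityʳ _) ⟨
      2 * ⌈ n /2⌉                        ≤⟨ *-monoʳ-≤ 2 (rec (⌈n/2⌉<n k)) ⟩
      2 * 2 ^ ⌈log₂ ⌈ n /2⌉ ⌉            ≡⟨ cong (λ e → 2 * 2 ^ e) (⌈log₂⌈n/2⌉⌉≡⌈log₂n⌉∸1 n) ⟩
      2 ^ suc (⌈log₂ n ⌉ ∸ 1)            ≡⟨ cong (2 ^_) (m+[n∸m]≡n (⌈log₂⌉-mono-≤ {2} {n} (s≤s (s≤s z≤n)))) ⟩
      2 ^ ⌈log₂ n ⌉                      ∎
      where open ≤-Reasoning

  sqrt : ∀ n → ∃ λ r → r * r ≤ n × n < suc r * suc r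
  sqrt zero    = 0 , z≤n , s≤s z≤n
  sqrt (suc n) with sqrt n
  ... | r , r²≤n , n<s² with suc r * suc r ≤? suc n
  ... | yes s²≤ = suc r , s²≤ , ≤-<-trans n<s² (*-mono-< (n<1+n (suc r)) (n<1+n (suc r)))
  ... | no  s²≰ = r , m≤n⇒m≤1+n r²≤n , ≰⇒> s²≰

  -- 2m − 1 for m > 0: the total over all blocks drops both when a block splits and when it shrinks.
  events : ℕ → ℕ
  events zero    = zero
  events (suc m) = suc (m + m)

  events-mono : ∀ {a b} → a ≤ b → events a ≤ events b
  events-mono z≤n       = z≤n
  events-mono (s≤s a≤b) = s≤s (+-mono-≤ a≤b a≤b)

  events-< : ∀ {a b} → a < b → events a < events b
  events-< {zero}  (s≤s _)   = s≤s z≤n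
  events-< {suc a} {suc (suc b)} (s≤s (s≤s a≤b)) rewrite +-suc b b =
    s≤s (s≤s (m≤n⇒m≤1+n (+-mono-≤ a≤b a≤b)))

  events-split : ∀ {a b m} → 0 < a → 0 < b → a + b ≤ m → suc (events a + events b) ≤ events m
  events-split {suc a} {suc b} {m} _ _ le = begin
    suc (suc (a + a) + suc (b + b))   ≡⟨ eq a b ⟩
    events (suc a + suc b)            ≤⟨ events-mono le ⟩
    events m                          ∎
    where
    open ≤-Reasoning
    eq : ∀ a b → suc (suc (a + a) + suc (b + b)) ≡ suc ((a + suc b) + (a + suc b))
    eq = solve-∀

  -- Charging a separator to the smaller side of a split charges every vertex at most log₂ n times.
  weight : ℕ → ℕ
  weight m = m * ⌈log₂ m ⌉

  -- Since `2 * a ≤ m`, the logarithm for the smaller side drops by at least one, which frees one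
  -- unit for each of its `a` vertices.
  weight-double : ∀ {a b m} → a ≤ b → a + b ≤ m → a + (weight a + weight b) ≤ weight m
  weight-double {zero}      {b} {m} _   le = *-mono-≤ le (⌈log₂⌉-mono-≤ le)
  weight-double {a@(suc _)} {b} {m} a≤b le = begin
    a + (weight a + weight b)             ≡⟨ eq a b ⌈log₂ a ⌉ ⌈log₂ b ⌉ ⟩
    a * suc ⌈log₂ a ⌉ + b * ⌈log₂ b ⌉     ≡⟨ cong (λ e → a * e + b * ⌈log₂ b ⌉) (⌈log₂2*n⌉≡1+⌈log₂n⌉ a) ⟨
    a * ⌈log₂ 2 * a ⌉ + b * ⌈log₂ b ⌉     ≤⟨ +-mono-≤ (*-monoʳ-≤ a (⌈log₂⌉-mono-≤ 2a≤m)) (*-monoʳ-≤ b (⌈log₂⌉-mono-≤ b≤m)) ⟩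
    a * ⌈log₂ m ⌉ + b * ⌈log₂ m ⌉         ≡⟨ *-distribʳ-+ ⌈log₂ m ⌉ a b ⟨
    (a + b) * ⌈log₂ m ⌉                   ≤⟨ *-monoˡ-≤ ⌈log₂ m ⌉ le ⟩
    weight m                              ∎
    where
    open ≤-Reasoning
    eq : ∀ a b x y → a + (a * x + b * y) ≡ a * suc x + b * y
    eq = solve-∀
    b≤m : b ≤ m
    b≤m = ≤-trans (m≤n+m b a) le
    2a≤m : 2 * a ≤ m
    2a≤m = ≤-trans (+-monoʳ-≤ a (≤-trans (≤-reflexive (+-identityʳ a)) a≤b)) le

  weight-split : ∀ {x a b m} → x ≤ a → x ≤ b → a + b ≤ m → x + (weight a + weight b) ≤ weight m
  weight-split {x} {a} {b} x≤a x≤b le with ≤-total a b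
  ... | inj₁ a≤b = ≤-trans (+-monoˡ-≤ _ x≤a) (weight-double a≤b le)
  ... | inj₂ b≤a = ≤-trans (+-mono-≤ x≤b (≤-reflexive (+-comm (weight a) (weight b))))
                     (weight-double b≤a (≤-trans (≤-reflexive (+-comm b a)) le))

  module Growth (D : ℕ) .{{_ : NonZero D}} where

    -- `suc (b / D)` is the least layer size `l` with `b < D * l`, so this is the least size a ball
    -- can have after a step in which the test against `b` failed.
    grow : ℕ → ℕ
    grow b = b + suc (b / D)

    size : ℕ → ℕ
    size zero    = 0
    size (suc t) = grow (size t)

    grow-mono : ∀ {a b} → a ≤ b → grow a ≤ grow b
    grow-mono a≤b = +-mono-≤ a≤b (s≤s (/-monoˡ-≤ D a≤b))

    grow-≤ : ∀ {b l} → b < D * l → grow b ≤ b + l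
    grow-≤ {b} {l} lt = +-monoʳ-≤ b (m<n*o⇒m/o<n (subst (b <_) (*-comm D l) lt))

    size-linear : ∀ j t → size t + j * suc (size t / D) ≤ size (j + t)
    size-linear zero    t = ≤-reflexive (+-identityʳ _)
    size-linear (suc j) t = begin
      size t + (s + j * s)      ≡⟨ cong (size t +_) (+-comm s (j * s)) ⟩
      size t + (j * s + s)      ≡⟨ +-assoc (size t) (j * s) s ⟨
      size t + j * s + s        ≤⟨ +-mono-≤ ih (s≤s (/-monoˡ-≤ D (≤-trans (m≤m+n (size t) (j * s)) ih))) ⟩
      size (suc j + t)          ∎
      where
      open ≤-Reasoning
      s : ℕ
      s = suc (size t / D)
      ih : size t + j * s ≤ size (j + t)
      ih = size-linear j t

    -- From time `t` on every increment is at least `suc (size t / D)`, and `D` of these exceed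
    -- `size t`.
    size-double : ∀ t → 2 * size t ≤ size (D + t)
    size-double t = begin
      size t + (size t + 0)              ≡⟨ cong (size t +_) (+-identityʳ _) ⟩
      size t + size t                    ≤⟨ +-monoʳ-≤ (size t) (≤-trans (≤-reflexive (m≡m%n+[m/n]*n (size t) D)) below) ⟩
      size t + D * suc (size t / D)      ≤⟨ size-linear D t ⟩
      size (D + t)                       ∎
      where
      open ≤-Reasoning
      below : size t % D + size t / D * D ≤ D * suc (size t / D)
      below = ≤-trans (+-monoˡ-≤ _ (<⇒≤ (m%n<n (size t) D)))
        (≤-reflexive (*-comm (suc (size t / D)) D))

    2^k≤size : ∀ k → 2 ^ k ≤ size (k * D + 1)
    2^k≤size zero    = s≤s z≤n
    2^k≤size (suc k) rewrite +-assoc D (k * D) 1 =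
      ≤-trans (*-monoʳ-≤ 2 (2^k≤size k)) (size-double (k * D + 1))

    -- One step to reach size 1, then ⌈log₂ n⌉ doublings of `D` steps each, and a last step to
    -- exceed `n` strictly.
    radius : ℕ → ℕ
    radius n = suc (⌈log₂ n ⌉ * D + 1)

    n<size-radius : ∀ n → n < size (radius n)
    n<size-radius n = ≤-<-trans (≤-trans (n≤2^⌈log₂n⌉ n) (2^k≤size ⌈log₂ n ⌉)) (m<m+n _ (s≤s z≤n))

    -- t counts the steps in which the ball grew by the factor 1 + 1/D and s bounds
    -- those still to come in which the remainder shrinks by that factor.
    record Budget (n b c fuel : ℕ) : Set where
      constructor budget
      field
        t a s    : ℕ
        grown    : size t ≤ b
        total    : t + a ≡ radius n
        left     : c < size s
        enough   : a + s ≤ fuel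

    initial-budget : ∀ {n b c} → c ≤ n → Budget n b c (radius n + radius n)
    initial-budget {n} c≤n = budget 0 (radius n) (radius n) z≤n refl (≤-<-trans c≤n (n<size-radius n)) ≤-refl

    no-fuel : ∀ {n b c} → ¬ Budget n b c 0
    no-fuel (budget t zero zero _ _ () _)
    no-fuel (budget t zero (suc s) _ _ _ ())

    -- Here `l` is the layer, and `c` counts what lies outside the ball before the layer is
    -- absorbed. A failed test means that `l` is large against the ball, which advances `t`, or
    -- against the outer part, which lowers `s`.
    spend : ∀ {n b c fuel b′ c′ l} → b ≤ n → b + l ≤ b′ → c′ + l ≤ c →
            ¬ (D * l ≤ b × D * l ≤ c′) → Budget n b c (suc fuel) → Budget n b′ c′ fuel
    spend {n} {b} {c} {fuel} {b′} {c′} {l} b≤n b≤b′ c′≤c ¬stop (budget t a s grown total left enough)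
      with D * l ≤? b
    -- With `a` used up, `t` equals `radius n` and the ball would have more than `n` vertices.
    spend {n} {b} {c} {fuel} {b′} {c′} {l} b≤n b≤b′ c′≤c ¬stop (budget t zero s grown total left enough) | no ≰b =
      ⊥-elim (<⇒≱ (n<size-radius n)
        (≤-trans (≤-trans (≤-reflexive (cong size (trans (sym total) (+-identityʳ t)))) grown) b≤n))
    spend {n} {b} {c} {fuel} {b′} {c′} {l} b≤n b≤b′ c′≤c ¬stop (budget t (suc a) s grown total left enough) | no ≰b =
      budget (suc t) a s
        (≤-trans (≤-trans (grow-mono grown) (grow-≤ (≰⇒> ≰b))) b≤b′)
        (trans (sym (+-suc t a)) total)
        (≤-<-trans (≤-trans (m≤m+n c′ l) c′≤c) left)
        (s≤s⁻¹ enough)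
    spend {n} {b} {c} {fuel} {b′} {c′} {l} b≤n b≤b′ c′≤c ¬stop (budget t a (suc s) grown total left enough) | yes ≤b =
      budget t a s (≤-trans grown (≤-trans (m≤m+n b l) b≤b′)) total
        (≰⇒> λ size≤ → <⇒≱ left
          (≤-trans (≤-trans (grow-mono size≤) (grow-≤ (≰⇒> λ ≤c → ¬stop (≤b , ≤c)))) c′≤c))
        (s≤s⁻¹ (≤-trans (≤-reflexive (sym (+-suc a s))) enough))

  ^-distribʳ-* : ∀ q a b → (a * b) ^ q ≡ a ^ q * b ^ q
  ^-distribʳ-* zero    a b = refl
  ^-distribʳ-* (suc q) a b =
    trans (cong (a * b *_) (^-distribʳ-* q a b)) (interchange a b (a ^ q) (b ^ q))
    where
    interchange : ∀ a b c d → a * b * (c * d) ≡ a * c * (b * d)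
    interchange = solve-∀

  square-cancel-≤ : ∀ {x y} → x * x ≤ y * y → x ≤ y
  square-cancel-≤ {x} {y} le with x ≤? y
  ... | yes x≤y = x≤y
  ... | no  x≰y = ⊥-elim (<⇒≱ (*-mono-< (≰⇒> x≰y) (≰⇒> x≰y)) le)

  -- Comparing the squares avoids the half-integral exponent of n.
  power-bound : ∀ {p q n D L x} C → 2 * p ≤ q → 0 < n → D * D ≤ 4 * n → x ≤ C * (n * (D * L)) →
                x ^ q ≤ (2 * C) ^ q * n ^ (2 * q ∸ p) * L ^ q
  power-bound {p} {q} {n} {D} {L} {x} C 2p≤q 0<n D²≤4n x≤ = square-cancel-≤ (begin
    x ^ q * x ^ q                                         ≡⟨ ^-distribʳ-* q x x ⟨
    (x * x) ^ q                                           ≤⟨ ^-monoˡ-≤ q x²≤ ⟩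
    (c * c * (n * (n * n)) * (L * L)) ^ q                 ≡⟨ ^-distribʳ-* q (c * c * (n * (n * n))) (L * L) ⟩
    (c * c * (n * (n * n))) ^ q * (L * L) ^ q             ≡⟨ cong₂ _*_ (^-distribʳ-* q (c * c) (n * (n * n))) (^-distribʳ-* q L L) ⟩
    (c * c) ^ q * (n * (n * n)) ^ q * (L ^ q * L ^ q)     ≤⟨ *-monoˡ-≤ (L ^ q * L ^ q) (*-mono-≤ (≤-reflexive (^-distribʳ-* q c c)) cube≤) ⟩
    c ^ q * c ^ q * (n ^ e * n ^ e) * (L ^ q * L ^ q)     ≡⟨ regroup (c ^ q) (n ^ e) (L ^ q) ⟩
    (c ^ q * n ^ e * L ^ q) * (c ^ q * n ^ e * L ^ q)     ∎)
    where
    open ≤-Reasoning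
    instance
      _ : NonZero n
      _ = >-nonZero 0<n
    c e : ℕ
    c = 2 * C
    e = 2 * q ∸ p
    regroup : ∀ a b c → a * a * (b * b) * (c * c) ≡ (a * b * c) * (a * b * c)
    regroup = solve-∀
    eq₁ : ∀ C n D L → C * (n * (D * L)) * (C * (n * (D * L))) ≡ C * C * (n * n) * (L * L) * (D * D)
    eq₁ = solve-∀
    eq₂ : ∀ C n L → C * C * (n * n) * (L * L) * (4 * n) ≡ 2 * C * (2 * C) * (n * (n * n)) * (L * L)
    eq₂ = solve-∀
    x²≤ : x * x ≤ c * c * (n * (n * n)) * (L * L)
    x²≤ = begin
      x * x                                      ≤⟨ *-mono-≤ x≤ x≤ ⟩
      C * (n * (D * L)) * (C * (n * (D * L)))    ≡⟨ eq₁ C n D L ⟩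
      C * C * (n * n) * (L * L) * (D * D)        ≤⟨ *-monoʳ-≤ (C * C * (n * n) * (L * L)) D²≤4n ⟩
      C * C * (n * n) * (L * L) * (4 * n)        ≡⟨ eq₂ C n L ⟩
      c * c * (n * (n * n)) * (L * L)            ∎
    eq₃ : ∀ q → q + (q + q) + q ≡ 2 * q + 2 * q
    eq₃ = solve-∀
    eq₄ : ∀ e p → (e + p) + (e + p) ≡ e + e + 2 * p
    eq₄ = solve-∀
    p≤2q : p ≤ 2 * q
    p≤2q = ≤-trans (m≤m+n p (p + 0)) (≤-trans 2p≤q (m≤m+n q (q + 0)))
    -- The one place where ε ≤ 1/2 decides: 3q ≤ 2(2q - p) says just `2 * p ≤ q`.
    3q≤2e : q + (q + q) ≤ e + e
    3q≤2e = +-cancelʳ-≤ q _ _ (begin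
      q + (q + q) + q        ≡⟨ eq₃ q ⟩
      2 * q + 2 * q          ≡⟨ cong₂ _+_ (m∸n+n≡m p≤2q) (m∸n+n≡m p≤2q) ⟨
      (e + p) + (e + p)      ≡⟨ eq₄ e p ⟩
      e + e + 2 * p          ≤⟨ +-monoʳ-≤ (e + e) 2p≤q ⟩
      e + e + q              ∎)
    cube≤ : (n * (n * n)) ^ q ≤ n ^ e * n ^ e
    cube≤ = begin
      (n * (n * n)) ^ q                ≡⟨ ^-distribʳ-* q n (n * n) ⟩
      n ^ q * (n * n) ^ q              ≡⟨ cong (n ^ q *_) (^-distribʳ-* q n n) ⟩
      n ^ q * (n ^ q * n ^ q)          ≡⟨ cong (n ^ q *_) (^-distribˡ-+-* n q q) ⟨
      n ^ q * n ^ (q + q)              ≡⟨ ^-distribˡ-+-* n q (q + q) ⟨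
      n ^ (q + (q + q))                ≤⟨ ^-monoʳ-≤ n 3q≤2e ⟩
      n ^ (e + e)                      ≡⟨ ^-distribˡ-+-* n e e ⟩
      n ^ e * n ^ e                    ∎

open Arithmetic

-- Partial decompositions and ball growing

total : {n : ℕ} → (ℕ → ℕ) → List (VSet n) → ℕ
total h L = sum (map (λ X → h ∣ X ∣) L)

total-↭ : {n : ℕ} (h : ℕ → ℕ) {L L′ : List (VSet n)} → L ↭ L′ → total h L ≡ total h L′
total-↭ h p = sum-↭ (map⁺ _ p)

module Blocks {n : ℕ} (M : MDP n) where
  open Graph M
  open Classes
  open Covers

  -- L is a ghost list: the program only holds W, the union of the products X × X over X in L.
  record Partial (L : List (VSet n)) (S : VSet n) (W Q : ESet n) : Set where
    field
      stored⁺  : ∀ {X x y} → X ∈ˡ L → x ∈ X → y ∈ X → (x , y) ∈ᴱ W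
      stored⁻  : ∀ {x y} → (x , y) ∈ᴱ W → ∃ λ X → X ∈ˡ L × x ∈ X × y ∈ X
      disjoint : AllPairs Disjoint L
      freeS    : ∀ {X} → X ∈ˡ L → Disjoint X S
      freeQ    : ∀ {X x y} → X ∈ˡ L → x ∈ X → ¬ (x , y) ∈ᴱ Q
      classes′ : Classes Q
      avoids′  : ∀ {x y} → (x , y) ∈ᴱ Q → x ∉ S
      covers′  : ∀ {Z} → IsEC M Z → Disjoint Z S →
                 (∃ λ X → X ∈ˡ L × Z ⊆ X) ⊎ (∀ x y → x ∈ Z → y ∈ Z → (x , y) ∈ᴱ Q)

  open Partial

  initial-partial : Partial (⊤ ∷ []) ⊥ (prodE ⊤ ⊤) (replicate n ⊥)
  initial-partial = record
    { stored⁺  = λ {_} {x} {y} _ _ _ → ∈prod⁺ ⊤ ⊤ {x} {y} ∈⊤ ∈⊤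
    ; stored⁻  = λ _ → ⊤ , here refl , ∈⊤ , ∈⊤
    ; disjoint = [] ∷ []
    ; freeS    = λ _ _ → ∉⊥
    ; freeQ    = λ _ _ → none
    ; classes′ = record
      { symQ = λ xy → ⊥-elim (none xy) ; transQ = λ xy _ → ⊥-elim (none xy) ; ecQ = λ xy → ⊥-elim (none xy) }
    ; avoids′  = λ _ → ∉⊥
    ; covers′  = λ _ _ → inj₁ (⊤ , here refl , ⊆⊤)
    }
    where
    none : ∀ {x y} → ¬ (x , y) ∈ᴱ replicate n ⊥
    none {x} {y} = ∉ᴱ∅ {n} {x} {y}

  partial⇒covers : ∀ {L S W Q} → Partial L S W Q → (∀ {x y} → ¬ (x , y) ∈ᴱ W) → Covers S Q
  partial⇒covers inv empty = record
    { classes = classes′ inv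
    ; avoids  = avoids′ inv
    ; covers  = λ ec dis → [ (λ { (X , X∈ , Z⊆X) → let z , z∈ = IsEC.nonempty ec in
                                 ⊥-elim (empty (stored⁺ inv X∈ (Z⊆X z∈) (Z⊆X z∈))) })
                           , (λ q → q _ _) ] (covers′ inv ec dis)
    }

  partial-↭ : ∀ {L L′ S W Q} → L ↭ L′ → Partial L S W Q → Partial L′ S W Q
  partial-↭ p inv = record
    { stored⁺  = λ X∈ → stored⁺ inv (back X∈)
    ; stored⁻  = λ xy → let X , X∈ , xs = stored⁻ inv xy in X , ∈-resp-↭ p X∈ , xs
    ; disjoint = Permₛ.AllPairs-resp-↭ (setoid (VSet n)) Disjoint-sym (resp₂ Disjoint) (↭⇒↭ₛ p) (disjoint inv)
    ; freeS    = λ X∈ → freeS inv (back X∈)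
    ; freeQ    = λ X∈ → freeQ inv (back X∈)
    ; classes′ = classes′ inv
    ; avoids′  = avoids′ inv
    ; covers′  = λ ec dis → Sum.map (λ { (X , X∈ , Z⊆X) → X , ∈-resp-↭ p X∈ , Z⊆X }) (λ q → q) (covers′ inv ec dis)
    }
    where
    back : ∀ {X} → X ∈ˡ _ → X ∈ˡ _
    back = ∈-resp-↭ (↭-sym p)

  module _ {X L S W Q} (inv : Partial (X ∷ L) S W Q) where

    private
      apart : ∀ {Y} → Y ∈ˡ L → Disjoint X Y
      apart Y∈ with disjoint inv
      ... | d ∷ _ = All.lookup d Y∈

      apart-L : AllPairs Disjoint L
      apart-L with disjoint inv
      ... | _ ∷ ds = ds

      W′ : ESet n
      W′ = binE diff W (prodE X X)

    -- Disjointness of the blocks makes the row of any member equal to its block; this is how the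
    -- program recovers a block from one edge of `W`.
    stored-row : ∀ {x} → x ∈ X → lookup W x ≡ X
    stored-row {x} x∈X = ⊆-antisym (λ z∈ → inX (stored⁻ inv (row⁻ W z∈)))
                                   (λ z∈ → row⁺ W (stored⁺ inv (here refl) x∈X z∈))
      where
      inX : ∀ {z} → (∃ λ Y → Y ∈ˡ X ∷ L × x ∈ Y × z ∈ Y) → z ∈ X
      inX (Y , here refl , _ , z∈) = z∈
      inX (Y , there Y∈ , x∈ , _)  = ⊥-elim (apart Y∈ x∈X x∈)

    private
      rest⁺ : ∀ {Y x y} → Y ∈ˡ L → x ∈ Y → y ∈ Y → (x , y) ∈ᴱ W′
      rest⁺ Y∈ x∈ y∈ = ∈ᴱ─⁺ W (prodE X X) (stored⁺ inv (there Y∈) x∈ y∈)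
        λ p → apart Y∈ (proj₁ (∈prod⁻ X X p)) x∈

      rest⁻ : ∀ {x y} → (x , y) ∈ᴱ W′ → ∃ λ Y → Y ∈ˡ L × x ∈ Y × y ∈ Y
      rest⁻ xy with ∈ᴱ─⁻ W (prodE X X) xy
      ... | p , ¬XX with stored⁻ inv p
      ... | Y , here refl , x∈ , y∈ = ⊥-elim (¬XX (∈prod⁺ X X x∈ y∈))
      ... | Y , there Y∈  , x∈ , y∈ = Y , Y∈ , x∈ , y∈

    finish : IsEC M X → Partial L S W′ (binE union Q (prodE X X))
    finish ec = record
      { stored⁺  = rest⁺
      ; stored⁻  = rest⁻
      ; disjoint = apart-L
      ; freeS    = λ Y∈ → freeS inv (there Y∈)
      ; freeQ    = λ Y∈ x∈ xy → [ freeQ inv (there Y∈) x∈ , (λ p → apart Y∈ (proj₁ (∈prod⁻ X X p)) x∈) ]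
                                 (∈ᴱ∪⁻ Q (prodE X X) xy)
      ; classes′ = add-class (classes′ inv) (λ _ → ec) (λ x∈ xy → ⊥-elim (freeQ inv (here refl) x∈ xy))
      ; avoids′  = λ xy → [ avoids′ inv , (λ p → freeS inv (here refl) (proj₁ (∈prod⁻ X X p))) ]
                            (∈ᴱ∪⁻ Q (prodE X X) xy)
      ; covers′  = cvr
      }
      where
      cvr : ∀ {Z} → IsEC M Z → Disjoint Z S → (∃ λ Y → Y ∈ˡ L × Z ⊆ Y) ⊎
            (∀ x y → x ∈ Z → y ∈ Z → (x , y) ∈ᴱ binE union Q (prodE X X))
      cvr ec dis with covers′ inv ec dis
      ... | inj₁ (Y , here refl , Z⊆X) = inj₂ λ _ _ x∈ y∈ →
              ∈ᴱ∪⁺ Q (prodE X X) (inj₂ (∈prod⁺ X X (Z⊆X x∈) (Z⊆X y∈)))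
      ... | inj₁ (Y , there Y∈ , Z⊆Y)  = inj₁ (Y , Y∈ , Z⊆Y)
      ... | inj₂ q                     = inj₂ λ _ _ x∈ y∈ → ∈ᴱ∪⁺ Q (prodE X X) (inj₁ (q _ _ x∈ y∈))

    -- All that matters of a split is that components inside `X` avoiding `T` fall on one side. A
    -- side may be empty: its square adds nothing to `W`.
    split : ∀ {B A T} → B ⊆ X → A ⊆ X → T ⊆ X → Disjoint B A → Disjoint B T → Disjoint A T →
            (∀ {Z} → IsEC M Z → Z ⊆ X → Disjoint Z T → Z ⊆ B ⊎ Z ⊆ A) →
            Partial (B ∷ A ∷ L) (S ∪ T) (binE union (binE union W′ (prodE B B)) (prodE A A)) Q
    split {B} {A} {T} B⊆X A⊆X T⊆X BA BT AT div = record
      { stored⁺  = st⁺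
      ; stored⁻  = λ xy → st⁻ (Sum.map₁ (∈ᴱ∪⁻ W′ (prodE B B)) (∈ᴱ∪⁻ W″ (prodE A A) xy))
      ; disjoint = (BA ∷ All.tabulate (λ Y∈ x∈ → apart Y∈ (B⊆X x∈))) ∷
                   All.tabulate (λ Y∈ x∈ → apart Y∈ (A⊆X x∈)) ∷ apart-L
      ; freeS    = frS
      ; freeQ    = λ { (here refl)         x∈ → freeQ inv (here refl) (B⊆X x∈)
                     ; (there (here refl)) x∈ → freeQ inv (here refl) (A⊆X x∈)
                     ; (there (there Y∈))  x∈ → freeQ inv (there Y∈) x∈ }
      ; classes′ = classes′ inv
      ; avoids′  = λ xy x∈ → [ avoids′ inv xy , (λ x∈T → freeQ inv (here refl) (T⊆X x∈T) xy) ] (x∈p∪q⁻ S T x∈)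
      ; covers′  = cvr
      }
      where
      W″ : ESet n
      W″ = binE union W′ (prodE B B)
      st⁺ : ∀ {Y x y} → Y ∈ˡ B ∷ A ∷ L → x ∈ Y → y ∈ Y → (x , y) ∈ᴱ binE union W″ (prodE A A)
      st⁺ (here refl)         x∈ y∈ = ∈ᴱ∪⁺ W″ _ (inj₁ (∈ᴱ∪⁺ W′ _ (inj₂ (∈prod⁺ B B x∈ y∈))))
      st⁺ (there (here refl)) x∈ y∈ = ∈ᴱ∪⁺ W″ _ (inj₂ (∈prod⁺ A A x∈ y∈))
      st⁺ (there (there Y∈))  x∈ y∈ = ∈ᴱ∪⁺ W″ _ (inj₁ (∈ᴱ∪⁺ W′ _ (inj₁ (rest⁺ Y∈ x∈ y∈))))
      st⁻ : ∀ {x y} → ((x , y) ∈ᴱ W′ ⊎ (x , y) ∈ᴱ prodE B B) ⊎ (x , y) ∈ᴱ prodE A A →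
            ∃ λ Y → Y ∈ˡ B ∷ A ∷ L × x ∈ Y × y ∈ Y
      st⁻ (inj₁ (inj₁ p)) = let Y , Y∈ , xs = rest⁻ p in Y , there (there Y∈) , xs
      st⁻ (inj₁ (inj₂ p)) = B , here refl , ∈prod⁻ B B p
      st⁻ (inj₂ p)        = A , there (here refl) , ∈prod⁻ A A p
      frS : ∀ {Y} → Y ∈ˡ B ∷ A ∷ L → Disjoint Y (S ∪ T)
      frS (here refl)         x∈ x∈S = [ freeS inv (here refl) (B⊆X x∈) , BT x∈ ] (x∈p∪q⁻ S T x∈S)
      frS (there (here refl)) x∈ x∈S = [ freeS inv (here refl) (A⊆X x∈) , AT x∈ ] (x∈p∪q⁻ S T x∈S)
      frS (there (there Y∈))  x∈ x∈S =
        [ freeS inv (there Y∈) x∈ , (λ x∈T → apart Y∈ (T⊆X x∈T) x∈) ] (x∈p∪q⁻ S T x∈S)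
      cvr : ∀ {Z} → IsEC M Z → Disjoint Z (S ∪ T) → (∃ λ Y → Y ∈ˡ B ∷ A ∷ L × Z ⊆ Y) ⊎
            (∀ x y → x ∈ Z → y ∈ Z → (x , y) ∈ᴱ Q)
      cvr ec dis with covers′ inv ec (λ x∈ x∈S → dis x∈ (∪⁺ˡ T x∈S))
      ... | inj₂ q = inj₂ q
      ... | inj₁ (Y , there Y∈ , Z⊆Y) = inj₁ (Y , there (there Y∈) , Z⊆Y)
      ... | inj₁ (Y , here refl , Z⊆X) with div ec Z⊆X (λ x∈ x∈T → dis x∈ (∪⁺ʳ S x∈T))
      ... | inj₁ Z⊆B = inj₁ (B , here refl , Z⊆B)
      ... | inj₂ Z⊆A = inj₁ (A , there (here refl) , Z⊆A)

  -- The chooser may pick from any block, so the ghost list is permuted to bring that block to the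
  -- front.
  extract : ∀ {L S W Q x y} → Partial L S W Q → (x , y) ∈ᴱ W →
            ∃₂ λ X L′ → L ↭ X ∷ L′ × Partial (X ∷ L′) S W Q × x ∈ X
  extract inv xy with stored⁻ inv xy
  ... | X , X∈ , x∈ , _ with ∈-∃++ X∈
  ... | L₁ , L₂ , refl = X , L₁ ++ L₂ , shift X L₁ L₂ , partial-↭ (shift X L₁ L₂) inv , x∈

  record Ball (d : Dir) (X : VSet n) (r : Fin n) (B : VSet n) : Set where
    field
      root∈  : r ∈ B
      within : B ⊆ X
      paths  : ∀ {x} → x ∈ B → Path d X r x

  open Ball

  layer : Dir → VSet n → VSet n → VSet n
  layer d X B = (img d (E M) B ∩ X) ─ B

  ∈layer⁻ : ∀ d X B {y} → y ∈ layer d X B → (∃ λ x → Step d x y × x ∈ B) × y ∈ X × y ∉ B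
  ∈layer⁻ d X B y∈ with ∈─⁻ (img d (E M) B ∩ X) B y∈
  ... | y∈∩ , y∉B with x∈p∩q⁻ (img d (E M) B) X y∈∩
  ... | y∈img , y∈X = ∈img⁻ d y∈img , y∈X , y∉B

  initial-ball : ∀ d {X r} → r ∈ X → Ball d X r ⁅ r ⁆
  initial-ball d {X} {r} r∈X = record
    { root∈  = x∈⁅x⁆ r
    ; within = λ x∈ → subst (_∈ X) (sym (x∈⁅y⁆⇒x≡y r x∈)) r∈X
    ; paths  = λ x∈ → subst (Path d X r) (sym (x∈⁅y⁆⇒x≡y r x∈)) (path-refl d r∈X)
    }

  grow-ball : ∀ d {X r B} → Ball d X r B → Ball d X r (B ∪ layer d X B)
  grow-ball d {X} {r} {B} ball = record
    { root∈  = ∪⁺ˡ _ (root∈ ball)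
    ; within = ∪-⊆ (within ball) (λ y∈ → proj₁ (proj₂ (∈layer⁻ d X B y∈)))
    ; paths  = λ y∈ → [ paths ball , new ] (x∈p∪q⁻ B _ y∈)
    }
    where
    new : ∀ {y} → y ∈ layer d X B → Path d X r y
    new y∈ = let (x , xy , x∈) , y∈X , _ = ∈layer⁻ d X B y∈ in path-snoc d (paths ball x∈) xy y∈X

  module _ (d : Dir) (X B : VSet n) where

    outer : VSet n
    outer = X ─ (B ∪ layer d X B)

    layer⊆ : layer d X B ⊆ X
    layer⊆ y∈ = proj₁ (proj₂ (∈layer⁻ d X B y∈))

    outer⊆ : outer ⊆ X
    outer⊆ = p─q⊆p X _

    ball-outer : Disjoint B outer
    ball-outer x∈B x∈ = proj₂ (∈─⁻ X _ x∈) (∪⁺ˡ _ x∈B)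

    ball-layer : Disjoint B (layer d X B)
    ball-layer x∈B x∈ = proj₂ (proj₂ (∈layer⁻ d X B x∈)) x∈B

    outer-layer : Disjoint outer (layer d X B)
    outer-layer x∈ x∈T = proj₂ (∈─⁻ X _ x∈) (∪⁺ʳ B x∈T)

    no-step : ∀ {x y} → x ∈ B → y ∈ outer → ¬ Step d x y
    no-step x∈ y∈ xy = let y∈X , y∉ = ∈─⁻ X _ y∈ in
      y∉ (∪⁺ʳ B (x∈p∧x∉q⇒x∈p─q (x∈p∩q⁺ (∈img⁺ d xy x∈ , y∈X)) λ y∈B → y∉ (∪⁺ˡ _ y∈B)))

    -- Without the layer no step in direction `d` leads from the ball to the outer part. For
    -- backward steps this forbids edges from the outer part into the ball, so the two sides swap
    -- roles.
    divide : ∀ {Z} → IsEC M Z → Z ⊆ X → Disjoint Z (layer d X B) → Z ⊆ B ⊎ Z ⊆ outer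
    divide {Z} ec Z⊆X dis = go d refl
      where
      side : ∀ {x} → x ∈ Z → x ∈ B ⊎ x ∈ outer
      side {x} x∈Z with x ∈? B
      ... | yes x∈B = inj₁ x∈B
      ... | no  x∉B = inj₂ (x∈p∧x∉q⇒x∈p─q (Z⊆X x∈Z) λ x∈ → [ x∉B , dis x∈Z ] (x∈p∪q⁻ B _ x∈))
      go : ∀ d′ → d′ ≡ d → Z ⊆ B ⊎ Z ⊆ outer
      go forward  refl = ec-split ec side ball-outer no-step
      go backward refl = Sum.swap (ec-split ec (λ x∈ → Sum.swap (side x∈)) (Disjoint-sym ball-outer)
                           (λ y∈ x∈ → no-step x∈ y∈))

-- The symbolic program and its cost

-- Bounds every branch of the tree, whatever the answers, so that cost needs neither a valid chooser
-- nor any invariant. Loads and outputs are free, as in `run`.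
Cost : ∀ {n kv ke} → Prog n kv ke → ℕ → Set
Cost halt              c       = Unit
Cost (emit _ p)        c       = Cost p c
Cost (loadV _ _ p)     c       = Cost p c
Cost (loadE _ _ p)     c       = Cost p c
Cost (vbin _ _ _ _ p)  (suc c) = Cost p c
Cost (ebin _ _ _ _ p)  (suc c) = Cost p c
Cost (vtest _ _ _ k)   (suc c) = ∀ b → Cost (k b) c
Cost (etest _ _ _ k)   (suc c) = ∀ b → Cost (k b) c
Cost (prod _ _ _ p)    (suc c) = Cost p c
Cost (pre _ _ _ p)     (suc c) = Cost p c
Cost (post _ _ _ p)    (suc c) = Cost p c
Cost (vpick _ _ k)     (suc c) = ∀ v → Cost (k v) c
Cost (epick _ _ k)     (suc c) = ∀ e → Cost (k e) c
Cost (vcard _ k)       (suc c) = ∀ m → Cost (k m) c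
Cost (ecard _ k)       (suc c) = ∀ m → Cost (k m) c
Cost _                 zero    = Absurd

module _ {n kv ke : ℕ} where

  cost-weaken : ∀ (p : Prog n kv ke) {c c′} → c ≤ c′ → Cost p c → Cost p c′
  cost-weaken halt             le       h = unit
  cost-weaken (emit _ p)       le       h = cost-weaken p le h
  cost-weaken (loadV _ _ p)    le       h = cost-weaken p le h
  cost-weaken (loadE _ _ p)    le       h = cost-weaken p le h
  cost-weaken (vbin _ _ _ _ p) (s≤s le) h = cost-weaken p le h
  cost-weaken (ebin _ _ _ _ p) (s≤s le) h = cost-weaken p le h
  cost-weaken (vtest _ _ _ k)  (s≤s le) h = λ b → cost-weaken (k b) le (h b)
  cost-weaken (etest _ _ _ k)  (s≤s le) h = λ b → cost-weaken (k b) le (h b)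
  cost-weaken (prod _ _ _ p)   (s≤s le) h = cost-weaken p le h
  cost-weaken (pre _ _ _ p)    (s≤s le) h = cost-weaken p le h
  cost-weaken (post _ _ _ p)   (s≤s le) h = cost-weaken p le h
  cost-weaken (vpick _ _ k)    (s≤s le) h = λ v → cost-weaken (k v) le (h v)
  cost-weaken (epick _ _ k)    (s≤s le) h = λ e → cost-weaken (k e) le (h e)
  cost-weaken (vcard _ k)      (s≤s le) h = λ m → cost-weaken (k m) le (h m)
  cost-weaken (ecard _ k)      (s≤s le) h = λ m → cost-weaken (k m) le (h m)

  cost-sound : ∀ (p : Prog n kv ke) {c} → Cost p c → ∀ M ch R Q i → ops (run p M ch R Q i) ≤ c + i
  tick : ∀ (p : Prog n kv ke) {c} → Cost p c → ∀ M ch R Q i → ops (run p M ch R Q (suc i)) ≤ suc c + i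

  tick p {c} h M ch R Q i =
    ℕₚ.≤-trans (cost-sound p h M ch R Q (suc i)) (ℕₚ.≤-reflexive (ℕₚ.+-suc c i))

  cost-sound halt {c}                     h M ch R Q i = ℕₚ.m≤n+m i c
  cost-sound (emit _ p)                   h M ch R Q i = cost-sound p h M ch R Q i
  cost-sound (loadV _ _ p)                h M ch R Q i = cost-sound p h M ch _ Q i
  cost-sound (loadE _ _ p)                h M ch R Q i = cost-sound p h M ch R _ i
  cost-sound (vbin _ _ _ _ p) {suc c}     h M ch R Q i = tick p h M ch _ Q i
  cost-sound (ebin _ _ _ _ p) {suc c}     h M ch R Q i = tick p h M ch R _ i
  cost-sound (vtest _ _ _ k)  {suc c}     h M ch R Q i = tick (k _) (h _) M ch R Q i
  cost-sound (etest _ _ _ k)  {suc c}     h M ch R Q i = tick (k _) (h _) M ch R Q i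
  cost-sound (prod _ _ _ p)   {suc c}     h M ch R Q i = tick p h M ch R _ i
  cost-sound (pre _ _ _ p)    {suc c}     h M ch R Q i = tick p h M ch _ Q i
  cost-sound (post _ _ _ p)   {suc c}     h M ch R Q i = tick p h M ch _ Q i
  cost-sound (vpick a d k)    {suc c}     h M ch R Q i with Chooser.chooseV ch i (lookup R a)
  ... | just v  = tick (k (just v)) (h _) M ch _ Q i
  ... | nothing = tick (k nothing) (h _) M ch _ Q i
  cost-sound (epick a d k)    {suc c}     h M ch R Q i with Chooser.chooseE ch i (lookup Q a)
  ... | just e  = tick (k (just e)) (h _) M ch R _ i
  ... | nothing = tick (k nothing) (h _) M ch R _ i
  cost-sound (vcard _ k)      {suc c}     h M ch R Q i = tick (k _) (h _) M ch R Q i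
  cost-sound (ecard _ k)      {suc c}     h M ch R Q i = tick (k _) (h _) M ch R Q i

  whenDec : {P : Set} → Dec P → Prog n kv ke → Prog n kv ke → Prog n kv ke
  whenDec d p q = if ⌊ d ⌋ then p else q

  cost-if : ∀ b {p q : Prog n kv ke} {c} → Cost p c → Cost q c → Cost (if b then p else q) c
  cost-if true  hp hq = hp
  cost-if false hp hq = hq

-- `m` is the fuel for reinserting separator vertices and `r` the fuel of one ball search. When
-- `shrink`, `spread` or `ball` runs out of fuel the program halts, which correctness shows never to
-- happen.
module Program (n D m r : ℕ) where

  Program : Set
  Program = Prog n 7 3

  rX rB rT rA rS rZ rG : Fin 7
  rX = # 0 ; rB = # 1 ; rT = # 2 ; rA = # 3 ; rS = # 4 ; rZ = # 5 ; rG = # 6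

  rW rQ rF : Fin 3
  rW = # 0 ; rQ = # 1 ; rF = # 2

  -- Expects a singleton {(u, w)} in rF; moves row u of rE to rX.
  takeBlock : Fin 3 → Program → Program
  takeBlock rE k =
    loadV cV rA $ pre rF rA rT $ post rE rT rX $ prod rX rX rF $ ebin diff rE rF rE k

  phase₃ : ℕ → Program
  phase₃ zero    = halt
  phase₃ (suc f) = epick rQ rF $ maybe′ (const $ takeBlock rQ $ emit rX $ phase₃ f) halt

  shrink : ℕ → Program → Program
  shrink zero    k = halt
  shrink (suc f) k =
    loadE cE rF $ ebin diff rF rQ rF $ pre rF rG rT $ vbin inter rT rG rT $
    post rQ rT rA $ vbin union rT rA rT $
    loadV cV rA $ vbin diff rA rG rA $ loadE cE rF $ pre rF rA rA $
    loadV cVᴿ rB $ vbin inter rA rB rA $ vbin diff rT rA rT $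
    vtest subsetTest rG rT λ b → if b then k else (vbin inter rG rT rG $ shrink f k)

  spread : ℕ → Program → Program
  spread zero    k = halt
  spread (suc f) k =
    loadE cE rF $ post rF rB rT $ vbin inter rT rG rT $
    vtest subsetTest rT rB λ b → if b then k else (vbin union rB rT rB $ spread f k)

  phase₂ : ℕ → Program
  phase₂ zero    = phase₃ n
  phase₂ (suc f) =
    vpick rS rZ $ maybe′ (const $
      vbin diff rS rZ rS $ loadV cV rG $ vbin diff rG rS rG $
      -- The start set is empty if `v` has been pruned from `G`; then `spread` stops at once and
      -- only the trivial component can be added.
      shrink (suc n) $ vbin inter rZ rG rB $
      spread (suc n) $ loadV cV₁ rT $ vbin inter rT rZ rT $ vbin union rB rT rB $
      prod rB rB rF $ ebin union rQ rF rQ $ phase₂ f) (phase₃ n)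

  neighbours : Dir → Fin 3 → Fin 7 → Fin 7 → Program → Program
  neighbours forward  = post
  neighbours backward = pre

  ball : Dir → ℕ → Program → Program
  ball d zero    k = halt
  ball d (suc f) k =
    loadE cE rF $ neighbours d rF rB rT $ vbin inter rT rX rT $ vbin diff rT rB rT $
    vbin union rB rT rA $ vbin diff rX rA rA $
    vcard rB λ b → vcard rT λ t → vcard rA λ a →
    -- An empty layer passes the test, so an exhausted search ends here as well.
    whenDec (D * t ≤? b ×-dec D * t ≤? a) k (vbin union rB rT rB $ ball d f k)

  splitBlock : Program → Program
  splitBlock k =
    vbin union rS rT rS $ prod rB rB rF $ ebin union rW rF rW $ prod rA rA rF $ ebin union rW rF rW k

  grown : Dir → Program → Program → Program
  grown d full k =
    -- The union of `rZ` with itself copies the root into `rB`.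
    vbin union rZ rZ rB $ ball d r $ vtest subsetTest rX rB λ b → if b then full else splitBlock k

  phase₁ : ℕ → Program
  phase₁ zero    = phase₂ m
  phase₁ (suc f) =
    epick rW rF $ maybe′ (const $
      takeBlock rW $
      loadV cV rA $ vbin diff rA rX rA $ loadE cE rF $ pre rF rA rA $ loadV cVᴿ rT $ vbin inter rA rT rA $
      -- With `rB` and `rT` empty, `splitBlock` just replaces the block by what remains without its
      -- random exits.
      vbin diff rX rA rA $ loadV cEmpty rB $ loadV cEmpty rT $
      vtest subsetTest rX rA λ b → if b
        then (vpick rX rZ $ maybe′ (const $
               grown forward (grown backward (prod rX rX rF $ ebin union rQ rF rQ $ phase₁ f) (phase₁ f))
                             (phase₁ f)) halt)
        else splitBlock (phase₁ f)) (phase₂ m)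

  main : Program
  main = loadV cV rX $ prod rX rX rW $ phase₁ (events n)

  cost₃ cost₂ cost₁ : ℕ → ℕ
  cost₃ f       = f * 5
  cost₂ zero    = cost₃ n
  cost₂ (suc f) = 3 + (suc n * 11 + suc (suc n * 4 + (4 + cost₂ f)))
  cost₁ zero    = cost₂ m
  cost₁ (suc f) = 12 + (r * 9 + (2 + (r * 9 + (6 + cost₁ f))))

  cost-phase₃ : ∀ f → Cost (phase₃ f) (cost₃ f)
  cost-phase₃ zero    = unit
  cost-phase₃ (suc f) = λ { (just _) → cost-phase₃ f ; nothing → unit }

  cost-shrink : ∀ f {k c} → Cost k c → Cost (shrink f k) (f * 11 + c)
  cost-shrink zero            h = unit
  cost-shrink (suc f) {k} {c} h = λ
    { true  → cost-weaken k (ℕₚ.m≤n+m c (suc (f * 11))) h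
    ; false → cost-shrink f h }

  cost-spread : ∀ f {k c} → Cost k c → Cost (spread f k) (f * 4 + c)
  cost-spread zero            h = unit
  cost-spread (suc f) {k} {c} h = λ
    { true  → cost-weaken k (ℕₚ.m≤n+m c (suc (f * 4))) h
    ; false → cost-spread f h }

  -- An empty separator sends the program to `phase₃` with fuel left over.
  phase₃≤phase₂ : ∀ f → cost₃ n ≤ cost₂ f
  phase₃≤phase₂ zero    = ℕₚ.≤-refl
  phase₃≤phase₂ (suc f) = ℕₚ.≤-trans (phase₃≤phase₂ f)
    (ℕₚ.m≤n⇒m≤o+n 3 (ℕₚ.m≤n⇒m≤o+n (suc n * 11) (ℕₚ.m≤n⇒m≤1+n (ℕₚ.m≤n⇒m≤o+n (suc n * 4) (ℕₚ.m≤n+m _ 4)))))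

  cost-phase₂ : ∀ f → Cost (phase₂ f) (cost₂ f)
  cost-phase₂ zero    = cost-phase₃ n
  cost-phase₂ (suc f) = λ
    { (just _) → cost-shrink (suc n) (cost-spread (suc n) (cost-phase₂ f))
    ; nothing  → cost-weaken (phase₃ n) (ℕₚ.≤-trans (phase₃≤phase₂ f)
        (ℕₚ.m≤n⇒m≤o+n 2 (ℕₚ.m≤n⇒m≤o+n (suc n * 11) (ℕₚ.m≤n⇒m≤1+n (ℕₚ.m≤n⇒m≤o+n (suc n * 4) (ℕₚ.m≤n+m _ 4))))))
        (cost-phase₃ n) }

  cost-ball : ∀ d f {k c} → Cost k c → Cost (ball d f k) (f * 9 + c)
  cost-ball d        zero            h = unit
  cost-ball forward  (suc f) {k} {c} h = λ b t a →
    cost-if ⌊ D * t ≤? b ×-dec D * t ≤? a ⌋ {k} {vbin union rB rT rB $ ball forward f k} {suc (f * 9 + c)}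
      (cost-weaken k (ℕₚ.m≤n+m c (suc (f * 9))) h) (cost-ball forward f h)
  cost-ball backward (suc f) {k} {c} h = λ b t a →
    cost-if ⌊ D * t ≤? b ×-dec D * t ≤? a ⌋ {k} {vbin union rB rT rB $ ball backward f k} {suc (f * 9 + c)}
      (cost-weaken k (ℕₚ.m≤n+m c (suc (f * 9))) h) (cost-ball backward f h)

  cost-grown : ∀ d {full k c} → Cost full c → Cost (splitBlock k) c →
               Cost (grown d full k) (1 + (r * 9 + (1 + c)))
  cost-grown d h₁ h₂ = cost-ball d r λ { true → h₁ ; false → h₂ }

  phase₂≤phase₁ : ∀ f → cost₂ m ≤ cost₁ f
  phase₂≤phase₁ zero    = ℕₚ.≤-refl
  phase₂≤phase₁ (suc f) = ℕₚ.≤-trans (phase₂≤phase₁ f)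
    (ℕₚ.m≤n⇒m≤o+n 12 (ℕₚ.m≤n⇒m≤o+n (r * 9) (ℕₚ.m≤n⇒m≤o+n 2 (ℕₚ.m≤n⇒m≤o+n (r * 9) (ℕₚ.m≤n+m _ 6)))))

  cost-phase₁ : ∀ f → Cost (phase₁ f) (cost₁ f)
  cost-phase₁ zero    = cost-phase₂ m
  cost-phase₁ (suc f) = λ
    { (just _) → λ
      { true  → λ
        { (just _) → cost-grown forward
            (cost-grown backward (cost-weaken (phase₁ f) (ℕₚ.m≤n+m _ 3) rec) rec)
            (cost-weaken (splitBlock (phase₁ f)) {5 + cost₁ f}
              (ℕₚ.m≤n⇒m≤1+n (ℕₚ.m≤n⇒m≤o+n (r * 9) (ℕₚ.n≤1+n _))) rec)
        ; nothing → unit }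
      ; false → cost-weaken (splitBlock (phase₁ f)) {5 + cost₁ f}
          (ℕₚ.m≤n⇒m≤o+n 2 (ℕₚ.m≤n⇒m≤o+n (r * 9) (ℕₚ.m≤n⇒m≤o+n 2 (ℕₚ.m≤n⇒m≤o+n (r * 9) (ℕₚ.n≤1+n _))))) rec }
    ; nothing → cost-weaken (phase₂ m) (ℕₚ.≤-trans (phase₂≤phase₁ f)
        (ℕₚ.m≤n⇒m≤o+n 11 (ℕₚ.m≤n⇒m≤o+n (r * 9) (ℕₚ.m≤n⇒m≤o+n 2 (ℕₚ.m≤n⇒m≤o+n (r * 9) (ℕₚ.m≤n+m _ 6))))))
        (cost-phase₂ m) }
    where
    rec : Cost (phase₁ f) (cost₁ f)
    rec = cost-phase₁ f

  cost-main : Cost main (1 + cost₁ (events n))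
  cost-main = cost-phase₁ (events n)

-- Correctness of the program

module Semantics {n : ℕ} (M : MDP n) (ch : Chooser n) (valid : ValidChooser ch) where
  open Graph M
  open Insert M
  open Blocks M
  open Covers
  open Classes

  -- The step number is quantified because the chooser may depend on it; the registers alone then
  -- describe the state.
  record Sat (Φ : List (VSet n) → Set) {kv ke} (p : Prog n kv ke)
             (R : Vec (VSet n) kv) (Q : Vec (ESet n) ke) : Set where
    constructor sat
    field holds : ∀ i → Φ (outputs (run p M ch R Q i))

  open Sat

  weaken : ∀ {Φ Ψ kv ke} {p : Prog n kv ke} {R Q} → (∀ {Xs} → Φ Xs → Ψ Xs) → Sat Φ p R Q → Sat Ψ p R Q
  weaken imp s = sat λ i → imp (holds s i)

  -- Restating the state keeps the chain of register updates from being copied into every step.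
  at : ∀ {Φ kv ke} {p : Prog n kv ke} R Q → Sat Φ p R Q → Sat Φ p R Q
  at R Q s = s

  module _ {Φ : List (VSet n) → Set} {kv ke : ℕ} {R : Vec (VSet n) kv} {Q : Vec (ESet n) ke} where

    loadV! : ∀ {c d p} → Sat Φ p (R [ d ]≔ constV M c) Q → Sat Φ (loadV c d p) R Q
    loadV! s = sat λ i → holds s i

    loadE! : ∀ {c d p} → Sat Φ p R (Q [ d ]≔ constE M c) → Sat Φ (loadE c d p) R Q
    loadE! s = sat λ i → holds s i

    vbin! : ∀ {o a b d p} → Sat Φ p (R [ d ]≔ binV o (lookup R a) (lookup R b)) Q → Sat Φ (vbin o a b d p) R Q
    vbin! s = sat λ i → holds s (suc i)

    ebin! : ∀ {o a b d p} → Sat Φ p R (Q [ d ]≔ binE o (lookup Q a) (lookup Q b)) → Sat Φ (ebin o a b d p) R Q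
    ebin! s = sat λ i → holds s (suc i)

    prod! : ∀ {a b d p} → Sat Φ p R (Q [ d ]≔ prodE (lookup R a) (lookup R b)) → Sat Φ (prod a b d p) R Q
    prod! s = sat λ i → holds s (suc i)

    pre! : ∀ {f a d p} → Sat Φ p (R [ d ]≔ preE (lookup Q f) (lookup R a)) Q → Sat Φ (pre f a d p) R Q
    pre! s = sat λ i → holds s (suc i)

    post! : ∀ {f a d p} → Sat Φ p (R [ d ]≔ postE (lookup Q f) (lookup R a)) Q → Sat Φ (post f a d p) R Q
    post! s = sat λ i → holds s (suc i)

    vcard! : ∀ {a k} → Sat Φ (k ∣ lookup R a ∣) R Q → Sat Φ (vcard a k) R Q
    vcard! s = sat λ i → holds s (suc i)

    when! : ∀ {P : Set} {p q} (d : Dec P) → (P → Sat Φ p R Q) → (¬ P → Sat Φ q R Q) → Sat Φ (whenDec d p q) R Q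
    when! (yes P) s t = s P
    when! (no ¬P) s t = t ¬P

    vsubset! : ∀ {a b p q} → (lookup R a ⊆ lookup R b → Sat Φ p R Q) →
               (¬ (lookup R a ⊆ lookup R b) → Sat Φ q R Q) →
               Sat Φ (vtest subsetTest a b λ x → if x then p else q) R Q
    vsubset! {a} {b} s t = sat λ i → holds (when! (lookup R a ⊆? lookup R b) s t) (suc i)

    vpick! : ∀ {a d p q} → (∀ v → v ∈ lookup R a → Sat Φ p (R [ d ]≔ ⁅ v ⁆) Q) →
             (lookup R a ≡ ⊥ → Sat Φ q (R [ d ]≔ ⊥) Q) →
             Sat Φ (vpick a d (maybe′ (const p) q)) R Q
    vpick! {a} {d} {p} {q} s t = sat go
      where
      go : ∀ i → Φ (outputs (run (vpick a d (maybe′ (const p) q)) M ch R Q i))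
      go i with Chooser.chooseV ch i (lookup R a) in eq
      ... | just v  = holds (s v (ValidChooser.vJust valid i _ v eq)) (suc i)
      ... | nothing = holds (t (ValidChooser.vNothing valid i _ eq)) (suc i)

    epick! : ∀ {a d p q} → (∀ e → e ∈ᴱ lookup Q a → Sat Φ p R (Q [ d ]≔ singletonE e)) →
             (lookup Q a ≡ replicate n ⊥ → Sat Φ q R (Q [ d ]≔ replicate n ⊥)) →
             Sat Φ (epick a d (maybe′ (const p) q)) R Q
    epick! {a} {d} {p} {q} s t = sat go
      where
      go : ∀ i → Φ (outputs (run (epick a d (maybe′ (const p) q)) M ch R Q i))
      go i with Chooser.chooseE ch i (lookup Q a) in eq
      ... | just e  = holds (s e (ValidChooser.eJust valid i _ e eq)) (suc i)
      ... | nothing = holds (t (ValidChooser.eNothing valid i _ eq)) (suc i)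

  empty-edges : ∀ {F : ESet n} → F ≡ replicate n ⊥ → ∀ {x y} → ¬ (x , y) ∈ᴱ F
  empty-edges refl {x} {y} = ∉ᴱ∅ {n} {x} {y}

  -- The predecessors of all vertices under the single edge are just `u`, so the picked edge is
  -- traded for the row of its source.
  post-singleton : ∀ Q u w → postE Q (preE (singletonE (u , w)) ⊤) ≡ lookup Q u
  post-singleton Q u w = ⊆-antisym
    (λ x∈ → let y , yx , y∈ = ∈post⁻ Q (preE F ⊤) x∈
                z , yz , _  = ∈pre⁻ F ⊤ y∈
            in row⁺ Q (subst (λ v → (v , _) ∈ᴱ Q) (x∈⁅y⁆⇒x≡y u (proj₁ (∈prod⁻ ⁅ u ⁆ ⁅ w ⁆ yz))) yx))
    (λ x∈ → ∈post⁺ Q (preE F ⊤) (row⁻ Q x∈)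
              (∈pre⁺ F ⊤ (∈prod⁺ ⁅ u ⁆ ⁅ w ⁆ (x∈⁅x⁆ u) (x∈⁅x⁆ w)) ∈⊤))
    where
    F : ESet n
    F = singletonE (u , w)

  module _ (D : ℕ) .{{_ : NonZero D}} (m : ℕ) (enough : n * ⌈log₂ n ⌉ ≤ D * m) where
    open Growth D
    open Program n D m (radius n + radius n)

    vs : (X B T A S Z G : VSet n) → Vec (VSet n) 7
    vs X B T A S Z G = X ∷ B ∷ T ∷ A ∷ S ∷ Z ∷ G ∷ []

    es : (W Q F : ESet n) → Vec (ESet n) 3
    es W Q F = W ∷ Q ∷ F ∷ []

    -- The measure is the number of classified vertices, which drops as the class of `u` is removed.
    sat-phase₃ : ∀ f {X B T A S Z G W Q F} → Classes Q → ∣ preE Q ⊤ ∣ ≤ f →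
                 Sat (ListsClasses Q) (phase₃ f) (vs X B T A S Z G) (es W Q F)
    sat-phase₃ zero    {Q = Q} cl le = sat λ i → lists-nil {Q} λ xy →
      ℕₚ.<⇒≱ (∈⇒∣∣>0 (∈pre⁺ Q ⊤ xy ∈⊤)) le
    sat-phase₃ (suc f) {B = B} {S = S} {Z = Z} {G = G} {W = W} {Q = Q} cl le = epick!
      (λ { (u , w) uw → loadV! $ pre! $
           at (vs _ B (preE (singletonE (u , w)) ⊤) ⊤ S Z G) (es W Q (singletonE (u , w))) $
           post! $ prod! $ ebin! $
           sat λ i → emitted u w uw i _ (post-singleton Q u w) })
      (λ eq → sat λ i → lists-nil {Q} (empty-edges eq))
      where
      emitted : ∀ u w → (u , w) ∈ᴱ Q → ∀ i X → X ≡ lookup Q u → ∀ {T A F} →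
                ListsClasses Q (X ∷ outputs (run (phase₃ f) M ch (vs X B T A S Z G)
                                               (es W (binE diff Q (prodE X X)) F) i))
      emitted u w uw i X refl = lists-cons cl uu
        (holds (sat-phase₃ f (remove-classes cl uu) (s≤s⁻¹ (ℕₚ.<-≤-trans smaller le))) i)
        where
        uu : (u , u) ∈ᴱ Q
        uu = reflˡ cl uw
        smaller : ∣ preE (binE diff Q (prodE X X)) ⊤ ∣ < ∣ preE Q ⊤ ∣
        smaller = p⊂q⇒∣p∣<∣q∣
          ( (λ x∈ → let y , xy , y∈ = ∈pre⁻ (binE diff Q (prodE X X)) ⊤ x∈ in
                    ∈pre⁺ Q ⊤ (proj₁ (∈ᴱ─⁻ Q (prodE X X) xy)) y∈)
          , u , ∈pre⁺ Q ⊤ uw ∈⊤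
          , (λ u∈ → let y , uy , _ = ∈pre⁻ (binE diff Q (prodE X X)) ⊤ u∈ in
                    proj₂ (∈remove⁻ cl uu uy) (row⁺ Q uu)) )

    -- `S′` is the separator that still contains `v`, for which `Q` is known; the register already
    -- holds `S`, without `v`.
    sat-shrink : ∀ f {k X B T A S S′ Z G v W Q F} → Covers S′ Q → v ∈ S′ →
                 Candidate S v Q G → ∣ G ∣ < f →
                 (∀ {B T A F G} → Candidate S v Q G → G ⊆ refine Q G →
                  Sat (IsMECDecomposition M) k (vs X B T A S Z G) (es W Q F)) →
                 Sat (IsMECDecomposition M) (shrink f k) (vs X B T A S Z G) (es W Q F)
    sat-shrink (suc f) {X = X} {B} {T} {A} {S} {Z = Z} {G} {W = W} {Q} cov v∈ cand (s≤s le) next =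
      loadE! $ ebin! $ pre! $ vbin! $
      at (vs X B (escapes Q G) A S Z G) (es W Q (binE diff (E M) Q)) $
      post! $ vbin! $
      at (vs X B P (postE Q (escapes Q G)) S Z G) (es W Q (binE diff (E M) Q)) $
      loadV! $ vbin! $ loadE! $ pre! $
      at (vs X B P (preE (E M) (⊤ ─ G)) S Z G) (es W Q (E M)) $
      loadV! $ vbin! $ vbin! $
      at (vs X (Vᴿ M) (refine Q G) (exits G) S Z G) (es W Q (E M)) $ vsubset!
        (λ stable → next cand stable)
        (λ unstable → vbin! $ sat-shrink f cov v∈
          (refine-candidate (classes cov) (v∉Q cov v∈) cand)
          (ℕₚ.<-≤-trans (p⊂q⇒∣p∣<∣q∣ (p∩q⊆p G _ , smaller (⊈⇒∃ G _ unstable))) le) next)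
      where
      P : VSet n
      P = escapes Q G ∪ postE Q (escapes Q G)
      smaller : (∃ λ x → x ∈ G × x ∉ refine Q G) → ∃ λ x → x ∈ G × x ∉ G ∩ refine Q G
      smaller (x , x∈ , x∉) = x , x∈ , λ x∈∩ → x∉ (p∩q⊆q G _ x∈∩)

    sat-spread : ∀ f {Φ k X B T A S Z G v W Q F} → (v ∈ G → v ∈ B) →
                 (∀ {x} → x ∈ B → v ∈ G × Reach M G v x) → n < f + ∣ B ∣ →
                 (∀ {B T F} → (v ∈ G → v ∈ B) → (∀ {x} → x ∈ B → v ∈ G × Reach M G v x) →
                  (∀ {x y} → x ∈ B → x ⟶ y → y ∈ G → y ∈ B) →
                  Sat Φ k (vs X B T A S Z G) (es W Q F)) →
                 Sat Φ (spread f k) (vs X B T A S Z G) (es W Q F)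
    sat-spread zero    {B = B} v∈B fromv lt next = ⊥-elim (ℕₚ.<⇒≱ lt (∣p∣≤n B))
    sat-spread (suc f) {B = B} {G = G} {v = v} v∈B fromv lt next =
      loadE! $ post! $ vbin! $ vsubset!
        (λ sub → next v∈B fromv λ x∈ xy y∈G → sub (x∈p∩q⁺ (∈post⁺ (E M) B xy x∈ , y∈G)))
        (λ ¬sub → vbin! $ sat-spread f (λ v∈G → ∪⁺ˡ N (v∈B v∈G))
          (λ x∈ → [ fromv , new ] (x∈p∪q⁻ B N x∈))
          (ℕₚ.<-≤-trans lt (ℕₚ.≤-trans (ℕₚ.≤-reflexive (sym (ℕₚ.+-suc f ∣ B ∣)))
            (ℕₚ.+-monoʳ-≤ f (p⊂q⇒∣p∣<∣q∣ (p⊆p∪q N , bigger (⊈⇒∃ N B ¬sub)))))) next)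
      where
      N : VSet n
      N = postE (E M) B ∩ G
      new : ∀ {x} → x ∈ N → v ∈ G × Reach M G v x
      new x∈ = let x∈post , x∈G = x∈p∩q⁻ (postE (E M) B) G x∈
                   y , yx , y∈  = ∈post⁻ (E M) B x∈post
                   v∈G , p      = fromv y∈
               in v∈G , reach-snoc p yx x∈G
      bigger : (∃ λ x → x ∈ N × x ∉ B) → ∃ λ x → x ∈ B ∪ N × x ∉ B
      bigger (x , x∈ , x∉) = x , ∪⁺ʳ B x∈ , x∉

    sat-output : ∀ {X B T A S Z G W Q F} → Covers ⊥ Q →
                 Sat (IsMECDecomposition M) (phase₃ n) (vs X B T A S Z G) (es W Q F)
    sat-output {Q = Q} cov = weaken (lists-classes⇒decomposition cov) (sat-phase₃ n (classes cov) (∣p∣≤n (preE Q ⊤)))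

    sat-phase₂ : ∀ f {X B T A S Z G W Q F} → Covers S Q → ∣ S ∣ ≤ f →
                 Sat (IsMECDecomposition M) (phase₂ f) (vs X B T A S Z G) (es W Q F)
    sat-phase₂ zero    cov le =
      sat-output (subst (λ S → Covers S _) (Empty-unique λ { (x , x∈) → ℕₚ.<⇒≱ (∈⇒∣∣>0 x∈) le }) cov)
    sat-phase₂ (suc f) {S = S} cov le = vpick!
      (λ v v∈S → vbin! $ loadV! $ vbin! $
        sat-shrink (suc n) cov v∈S (initial-candidate cov v∈S) (s≤s (∣p∣≤n (⊤ ─ (S ─ ⁅ v ⁆)))) λ {_} {_} {_} {_} {G} cand stable →
        vbin! $ sat-spread (suc n) {v = v}
          (λ v∈G → x∈p∩q⁺ (x∈⁅x⁆ v , v∈G))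
          (λ x∈ → start (x∈p∩q⁻ ⁅ v ⁆ G x∈))
          (s≤s (ℕₚ.m≤m+n n _)) λ v∈B fromv closed →
        loadV! $ vbin! $ vbin! $ prod! $ ebin! $
        sat-phase₂ f (insert-covers cov v∈S cand stable v∈B fromv closed)
          (s≤s⁻¹ (ℕₚ.<-≤-trans (p∩q≢∅⇒∣p─q∣<∣p∣ S ⁅ v ⁆ (v , x∈p∩q⁺ (v∈S , x∈⁅x⁆ v))) le)))
      (λ { refl → sat-output cov })
      where
      start : ∀ {v G x} → x ∈ ⁅ v ⁆ × x ∈ G → v ∈ G × Reach M G v x
      start {v} (x∈v , x∈G) with x∈⁅y⁆⇒x≡y v x∈v
      ... | refl = x∈G , here x∈G

    -- The continuation receives both inequalities of the stopping test, since the layer is to be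
    -- charged to whichever side is smaller.
    sat-ball : ∀ d f {Φ k X B T A S Z G W Q F x} → Ball d X x B → Budget n ∣ B ∣ ∣ X ─ B ∣ f →
               (∀ {B F} → Ball d X x B → D * ∣ layer d X B ∣ ≤ ∣ B ∣ → D * ∣ layer d X B ∣ ≤ ∣ outer d X B ∣ →
                Sat Φ k (vs X B (layer d X B) (outer d X B) S Z G) (es W Q F)) →
               Sat Φ (ball d f k) (vs X B T A S Z G) (es W Q F)
    sat-ball d zero    bl bud next = ⊥-elim (no-fuel bud)
    sat-ball d (suc f) {Φ} {k} {X} {B} {T} {A} {S} {Z} {G} {W} {Q} bl bud next =
      loadE! $ neighbours! d $ vbin! $ vbin! $
      at (vs X B N A S Z G) (es W Q (E M)) $
      vbin! $ vbin! $
      at (vs X B N (outer d X B) S Z G) (es W Q (E M)) $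
      vcard! $ vcard! $ vcard! $
      when! (D * ∣ N ∣ ≤? ∣ B ∣ ×-dec D * ∣ N ∣ ≤? ∣ outer d X B ∣)
        (λ { (p , q) → next bl p q })
        (λ ¬stop → vbin! $ sat-ball d f (grow-ball d bl)
          (spend (∣p∣≤n B) (ℕₚ.≤-reflexive (disjoint-∣∪∣ B N (ball-layer d X B)))
            (disjoint-∣+∣≤ (outer-layer d X B)
              (λ y∈ → x∈p∧x∉q⇒x∈p─q (outer⊆ d X B y∈) λ y∈B → ball-outer d X B y∈B y∈)
              (λ y∈ → x∈p∧x∉q⇒x∈p─q (layer⊆ d X B y∈) λ y∈B → ball-layer d X B y∈B y∈))
            ¬stop bud) next)
      where
      N : VSet n
      N = layer d X B
      neighbours! : ∀ d {p R} {Q : Vec (ESet n) 3} {a b} → Sat Φ p (R [ b ]≔ img d (lookup Q rF) (lookup R a)) Q →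
                    Sat Φ (neighbours d rF a b p) R Q
      neighbours! forward  s = post! s
      neighbours! backward s = pre! s

    -- In `weightLeft` the separator is paid from the weight of the blocks. When no block is left to
    -- process, it bounds `D * ∣ S ∣` by n log n.
    record Progress (f : ℕ) (L : List (VSet n)) (S : VSet n) (W Q : ESet n) : Set where
      constructor progress
      field
        partial   : Partial L S W Q
        eventsLeft : total events L ≤ f
        weightLeft : D * ∣ S ∣ + total weight L ≤ n * ⌈log₂ n ⌉

    Phase₁ : ℕ → Set
    Phase₁ f = ∀ {L X B T A S Z G W Q F} → Progress f L S W Q →
               Sat (IsMECDecomposition M) (phase₁ f) (vs X B T A S Z G) (es W Q F)

    -- Serves both the split along a layer and the deletion of random exits, where `B` and `T` are
    -- empty. Either way the events must drop strictly, as they pay for the round.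
    sat-splitBlock : ∀ f → Phase₁ f → ∀ {X Y L B T A S Z G W Q F} → Progress (suc f) (Y ∷ L) S W Q →
                     B ⊆ Y → A ⊆ Y → T ⊆ Y → Disjoint B A → Disjoint B T → Disjoint A T →
                     (∀ {V} → IsEC M V → V ⊆ Y → Disjoint V T → V ⊆ B ⊎ V ⊆ A) →
                     events ∣ B ∣ + events ∣ A ∣ < events ∣ Y ∣ →
                     D * ∣ T ∣ + (weight ∣ B ∣ + weight ∣ A ∣) ≤ weight ∣ Y ∣ →
                     Sat (IsMECDecomposition M) (splitBlock (phase₁ f)) (vs X B T A S Z G)
                       (es (binE diff W (prodE Y Y)) Q F)
    sat-splitBlock f rec {X} {Y} {L} {B} {T} {A} {S} {Z} {G} {W} {Q} (progress inv ev wt) B⊆ A⊆ T⊆ BA BT AT div evs wts =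
      vbin! $ prod! $ ebin! $
      at (vs X B T A (S ∪ T) Z G) (es (binE union (binE diff W (prodE Y Y)) (prodE B B)) Q (prodE B B)) $
      prod! $ ebin! $ rec (progress (split inv B⊆ A⊆ T⊆ BA BT AT div) evLeft wtLeft)
      where
      open ℕₚ.≤-Reasoning
      evLeft : events ∣ B ∣ + (events ∣ A ∣ + total events L) ≤ f
      evLeft = s≤s⁻¹ (begin
        suc (events ∣ B ∣ + (events ∣ A ∣ + total events L)) ≡⟨ cong suc (ℕₚ.+-assoc (events ∣ B ∣) _ _) ⟨
        suc (events ∣ B ∣ + events ∣ A ∣) + total events L   ≤⟨ ℕₚ.+-monoˡ-≤ (total events L) evs ⟩
        total events (Y ∷ L)                                 ≤⟨ ev ⟩
        suc f                                                ∎)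
      arrange : ∀ s t b a l → s + t + (b + (a + l)) ≡ s + (t + (b + a) + l)
      arrange = solve-∀
      wtLeft : D * ∣ S ∪ T ∣ + (weight ∣ B ∣ + (weight ∣ A ∣ + total weight L)) ≤ n * ⌈log₂ n ⌉
      wtLeft = begin
        D * ∣ S ∪ T ∣ + w                                     ≤⟨ ℕₚ.+-monoˡ-≤ w (ℕₚ.*-monoʳ-≤ D (∣∪∣≤ S T)) ⟩
        D * (∣ S ∣ + ∣ T ∣) + w                               ≡⟨ cong (_+ w) (ℕₚ.*-distribˡ-+ D ∣ S ∣ ∣ T ∣) ⟩
        D * ∣ S ∣ + D * ∣ T ∣ + w                             ≡⟨ arrange (D * ∣ S ∣) (D * ∣ T ∣) (weight ∣ B ∣) (weight ∣ A ∣) (total weight L) ⟩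
        D * ∣ S ∣ + (D * ∣ T ∣ + (weight ∣ B ∣ + weight ∣ A ∣) + total weight L)
                                                              ≤⟨ ℕₚ.+-monoʳ-≤ (D * ∣ S ∣) (ℕₚ.+-monoˡ-≤ (total weight L) wts) ⟩
        D * ∣ S ∣ + total weight (Y ∷ L)                      ≤⟨ wt ⟩
        n * ⌈log₂ n ⌉                                         ∎
        where
        w : ℕ
        w = weight ∣ B ∣ + (weight ∣ A ∣ + total weight L)

    sat-grown : ∀ d f → Phase₁ f → ∀ {full Y L B T A S G W Q F x} → Progress (suc f) (Y ∷ L) S W Q → x ∈ Y →
                ((∀ {y} → y ∈ Y → Path d Y x y) → ∀ {B T A F} →
                 Sat (IsMECDecomposition M) full (vs Y B T A S ⁅ x ⁆ G) (es (binE diff W (prodE Y Y)) Q F)) →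
                Sat (IsMECDecomposition M) (grown d full (phase₁ f)) (vs Y B T A S ⁅ x ⁆ G)
                  (es (binE diff W (prodE Y Y)) Q F)
    sat-grown d f rec {Y = Y} {x = x} prg x∈Y next =
      vbin! $ sat-ball d (radius n + radius n)
        (subst (Ball d Y x) (sym (∪-idem ⁅ x ⁆)) (initial-ball d x∈Y))
        (initial-budget (∣p∣≤n (Y ─ (⁅ x ⁆ ∪ ⁅ x ⁆)))) λ {B} bl le₁ le₂ →
      vsubset!
        (λ sub → next λ y∈ → Ball.paths bl (sub y∈))
        (λ ¬sub → let both = disjoint-∣+∣≤ (ball-outer d Y B) (Ball.within bl) (outer⊆ d Y B) in
          sat-splitBlock f rec prg (Ball.within bl) (outer⊆ d Y B) (layer⊆ d Y B)
            (ball-outer d Y B) (ball-layer d Y B) (outer-layer d Y B) (divide d Y B)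
            (events-split (∈⇒∣∣>0 (Ball.root∈ bl)) (nonempty-outer B le₂ (⊈⇒∃ Y B ¬sub)) both)
            (weight-split le₁ le₂ both))
      where
      -- `events-split` needs two nonempty sides. If the vertex missed by the ball lies in the
      -- layer, the stopping test with `D > 0` still forces an outer vertex.
      nonempty-outer : ∀ B → D * ∣ layer d Y B ∣ ≤ ∣ outer d Y B ∣ → (∃ λ y → y ∈ Y × y ∉ B) → 0 < ∣ outer d Y B ∣
      nonempty-outer B le (y , y∈Y , y∉B) with y ∈? layer d Y B
      ... | yes y∈ = ℕₚ.<-≤-trans (ℕₚ.*-mono-≤ (>-nonZero⁻¹ D) (∈⇒∣∣>0 y∈)) le
      ... | no  y∉ = ∈⇒∣∣>0 (x∈p∧x∉q⇒x∈p─q y∈Y λ y∈ → [ y∉B , y∉ ] (x∈p∪q⁻ B _ y∈))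

    replaceX : ∀ {Φ} {p : Program} {X Y B T A S Z G} {Es : Vec (ESet n) 3} → X ≡ Y → Sat Φ p (vs Y B T A S Z G) Es → Sat Φ p (vs X B T A S Z G) Es
    replaceX refl s = s

    sat-block : ∀ f → Phase₁ f → ∀ {Y L B T A S Z G W Q F} → Progress (suc f) (Y ∷ L) S W Q → (∃ λ x → x ∈ Y) →
                Sat (IsMECDecomposition M)
                  (loadV cV rA $ vbin diff rA rX rA $ loadE cE rF $ pre rF rA rA $ loadV cVᴿ rT $ vbin inter rA rT rA $
                   vbin diff rX rA rA $ loadV cEmpty rB $ loadV cEmpty rT $
                   vtest subsetTest rX rA λ b → if b
                     then (vpick rX rZ $ maybe′ (const $
                            grown forward (grown backward (prod rX rX rF $ ebin union rQ rF rQ $ phase₁ f) (phase₁ f))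
                                          (phase₁ f)) halt)
                     else splitBlock (phase₁ f))
                  (vs Y B T A S Z G) (es (binE diff W (prodE Y Y)) Q F)
    sat-block f rec {Y} {L} {B} {T} {A} {S} {Z} {G} {W} {Q} prg@(progress inv ev wt) (x , x∈Y) =
      loadV! $ vbin! $ loadE! $ pre! $
      at (vs Y B T (preE (E M) (⊤ ─ Y)) S Z G) (es W′ Q (E M)) $
      loadV! $ vbin! $ vbin! $ loadV! $ loadV! $
      at (vs Y ⊥ ⊥ (Y ─ exits Y) S Z G) (es W′ Q (E M)) $
      vsubset!
        (λ closed → vpick!
          (λ r r∈Y → sat-grown forward f rec prg r∈Y λ from →
             sat-grown backward f rec prg r∈Y λ to →
             prod! $ ebin! $ rec (finished (ec closed r∈Y from to)))
          (λ { refl → ⊥-elim (∉⊥ x∈Y) }))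
        (λ ¬closed → let y , y∈Y , y∉ = ⊈⇒∃ Y (Y ─ exits Y) ¬closed in
          sat-splitBlock f rec prg (λ z∈ → ⊥-elim (∉⊥ z∈)) (p─q⊆p Y _) (λ z∈ → ⊥-elim (∉⊥ z∈))
            (λ z∈ _ → ∉⊥ z∈) (λ z∈ _ → ∉⊥ z∈) (λ _ → ∉⊥)
            (λ ec V⊆Y _ → inj₂ λ z∈ → x∈p∧x∉q⇒x∈p─q (V⊆Y z∈) (stays ec V⊆Y z∈))
            (fewer-events (p⊂q⇒∣p∣<∣q∣ (p─q⊆p Y _ , y , y∈Y , y∉)))
            less-weight)
      where
      W′ : ESet n
      W′ = binE diff W (prodE Y Y)
      stays : ∀ {V} → IsEC M V → V ⊆ Y → ∀ {z} → z ∈ V → z ∉ exits Y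
      stays ec V⊆Y {z} z∈V z∈ with x∈p∩q⁻ (preE (E M) (⊤ ─ Y)) (Vᴿ M) z∈
      ... | z∈pre , z∈R with ∈pre⁻ (E M) (⊤ ─ Y) z∈pre
      ... | w , zw , w∈ = proj₂ (∈─⁻ ⊤ Y w∈) (V⊆Y (IsEC.randomClosed ec z w z∈V z∈R zw))
      ec : Y ⊆ Y ─ exits Y → ∀ {r} → r ∈ Y → (∀ {y} → y ∈ Y → Reach M Y r y) → (∀ {y} → y ∈ Y → Reach M Y y r) → IsEC M Y
      ec closed r∈Y from to = record
        { nonempty = _ , r∈Y
        ; stronglyConnected = λ u v u∈ v∈ → reach-trans (to u∈) (from v∈)
        ; randomClosed = λ v w v∈ v∈R vw → inY v∈ v∈R vw
        }
        where
        inY : ∀ {v w} → v ∈ Y → v ∈ Vᴿ M → v ⟶ w → w ∈ Y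
        inY {v} {w} v∈ v∈R vw with w ∈? Y
        ... | yes w∈ = w∈
        ... | no  w∉ = ⊥-elim (proj₂ (∈─⁻ Y _ (closed v∈))
                (x∈p∩q⁺ (∈pre⁺ (E M) (⊤ ─ Y) vw (x∈p∧x∉q⇒x∈p─q ∈⊤ w∉) , v∈R)))
      finished : IsEC M Y → Progress f L S W′ (binE union Q (prodE Y Y))
      finished ec = progress (finish inv ec)
        (s≤s⁻¹ (ℕₚ.≤-trans (ℕₚ.+-monoˡ-≤ (total events L) (events-< (∈⇒∣∣>0 x∈Y))) ev))
        (ℕₚ.≤-trans (ℕₚ.+-monoʳ-≤ (D * ∣ S ∣) (ℕₚ.m≤n+m _ (weight ∣ Y ∣))) wt)
      fewer-events : ∣ Y ─ exits Y ∣ < ∣ Y ∣ → events ∣ ⊥ {n} ∣ + events ∣ Y ─ exits Y ∣ < events ∣ Y ∣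
      fewer-events lt rewrite ∣⊥∣≡0 n = events-< lt
      less-weight : D * ∣ ⊥ {n} ∣ + (weight ∣ ⊥ {n} ∣ + weight ∣ Y ─ exits Y ∣) ≤ weight ∣ Y ∣
      less-weight rewrite ∣⊥∣≡0 n | ℕₚ.*-zeroʳ D = ℕₚ.*-mono-≤ le (⌈log₂⌉-mono-≤ le)
        where
        le : ∣ Y ─ exits Y ∣ ≤ ∣ Y ∣
        le = p⊆q⇒∣p∣≤∣q∣ (p─q⊆p Y (exits Y))

    phase₁-done : ∀ {f L S W Q X B T A Z G F} → Progress f L S W Q → (∀ {x y} → ¬ (x , y) ∈ᴱ W) →
                  Sat (IsMECDecomposition M) (phase₂ m) (vs X B T A S Z G) (es W Q F)
    phase₁-done {S = S} (progress inv _ wt) empty = sat-phase₂ m (partial⇒covers inv empty)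
      (ℕₚ.*-cancelˡ-≤ D (ℕₚ.≤-trans (ℕₚ.m≤m+n (D * ∣ S ∣) _) (ℕₚ.≤-trans wt enough)))

    sat-phase₁ : ∀ f → Phase₁ f
    -- A nonempty block has at least one event, so without events `W` is already empty.
    sat-phase₁ zero prg@(progress inv ev wt) = phase₁-done prg λ xy →
      let X , L′ , p , _ , x∈ = extract inv xy in
      ℕₚ.<⇒≱ (ℕₚ.<-≤-trans (events-< (∈⇒∣∣>0 x∈)) (ℕₚ.m≤m+n _ (total events L′)))
        (ℕₚ.≤-trans (ℕₚ.≤-reflexive (sym (total-↭ events p))) ev)
    sat-phase₁ (suc f) {B = B} {S = S} {Z = Z} {G = G} {W = W} {Q = Q} prg@(progress inv ev wt) = epick!
      (λ { (u , w) uw → let Y , L′ , p , inv′ , u∈Y = extract inv uw in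
           loadV! $ pre! $
           at (vs _ B (preE (singletonE (u , w)) ⊤) ⊤ S Z G) (es W Q (singletonE (u , w))) $
           post! $ replaceX (trans (post-singleton W u w) (stored-row inv′ u∈Y)) $ prod! $ ebin! $
           sat-block f (sat-phase₁ f) (progress inv′
             (ℕₚ.≤-trans (ℕₚ.≤-reflexive (sym (total-↭ events p))) ev)
             (ℕₚ.≤-trans (ℕₚ.≤-reflexive (cong (D * ∣ S ∣ +_) (sym (total-↭ weight p)))) wt)) (u , u∈Y) })
      (λ eq → phase₁-done prg (empty-edges eq))

    sat-main : ∀ {X B T A Z G W F} →
               Sat (IsMECDecomposition M) main (vs X B T A ⊥ Z G) (es W (replicate n ⊥) F)
    sat-main = loadV! $ prod! $ sat-phase₁ (events n) (progress initial-partial evs wts)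
      where
      evs : total events (⊤ {n} ∷ []) ≤ events n
      evs rewrite ∣⊤∣≡n n = ℕₚ.≤-reflexive (ℕₚ.+-identityʳ _)
      wts : D * ∣ ⊥ {n} ∣ + total weight (⊤ {n} ∷ []) ≤ n * ⌈log₂ n ⌉
      wts rewrite ∣⊥∣≡0 n | ∣⊤∣≡n n | ℕₚ.*-zeroʳ D = ℕₚ.≤-reflexive (ℕₚ.+-identityʳ _)

-- Choice of D and the resulting operation count

root scale fuel₂ : ℕ → ℕ
root n  = proj₁ (sqrt n)
scale n = suc (root n)
fuel₂ n = scale n * ⌈log₂ n ⌉

-- Rounding √n up gives `n ≤ D * D`, so n log n / D is at most D log n, the fuel for reinsertion.
fuel₂-enough : ∀ n → n * ⌈log₂ n ⌉ ≤ scale n * fuel₂ n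
fuel₂-enough n = begin
  n * ⌈log₂ n ⌉                    ≤⟨ ℕₚ.*-monoˡ-≤ ⌈log₂ n ⌉ (ℕₚ.<⇒≤ (proj₂ (proj₂ (sqrt n)))) ⟩
  scale n * scale n * ⌈log₂ n ⌉    ≡⟨ ℕₚ.*-assoc (scale n) (scale n) ⌈log₂ n ⌉ ⟩
  scale n * fuel₂ n                ∎
  where open ℕₚ.≤-Reasoning

scale²≤4n : ∀ {n} → 0 < n → scale n * scale n ≤ 4 * n
scale²≤4n {n} 0<n = begin
  suc r * suc r          ≡⟨ expand r ⟩
  1 + r + r + r * r      ≤⟨ ℕₚ.+-mono-≤ (ℕₚ.+-mono-≤ (ℕₚ.+-mono-≤ 0<n r≤n) r≤n) r²≤n ⟩
  n + n + n + n          ≡⟨ collect n ⟩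
  4 * n                  ∎
  where
  open ℕₚ.≤-Reasoning
  r : ℕ
  r = root n
  r²≤n : r * r ≤ n
  r²≤n = proj₁ (proj₂ (sqrt n))
  square : ∀ x → x ≤ x * x
  square zero    = z≤n
  square (suc x) = ℕₚ.m≤m+n (suc x) (x * suc x)
  r≤n : r ≤ n
  r≤n = ℕₚ.≤-trans (square r) r²≤n
  expand : ∀ r → suc r * suc r ≡ 1 + r + r + r * r
  expand = solve-∀
  collect : ∀ n → n + n + n + n ≡ 4 * n
  collect = solve-∀

module MEC (n : ℕ) where
  open Growth (scale n)
  open Program n (scale n) (fuel₂ n) (radius n + radius n) public

  cost₂-closed : ∀ f → cost₂ f ≡ f * (23 + 15 * n) + n * 5
  cost₂-closed zero    = refl
  cost₂-closed (suc f) = trans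
    (cong (λ c → 3 + (suc n * 11 + suc (suc n * 4 + (4 + c)))) (cost₂-closed f)) (arrange n f)
    where
    arrange : ∀ n f → 3 + (suc n * 11 + suc (suc n * 4 + (4 + (f * (23 + 15 * n) + n * 5)))) ≡
                      suc f * (23 + 15 * n) + n * 5
    arrange = solve-∀

  cost₁-closed : ∀ f → cost₁ f ≡ f * (20 + (radius n + radius n) * 18) + cost₂ (fuel₂ n)
  cost₁-closed zero    = refl
  cost₁-closed (suc f) = trans
    (cong (λ c → 12 + (r * 9 + (2 + (r * 9 + (6 + c))))) (cost₁-closed f)) (arrange f r (cost₂ (fuel₂ n)))
    where
    r : ℕ
    r = radius n + radius n
    arrange : ∀ f r c → 12 + (r * 9 + (2 + (r * 9 + (6 + (f * (20 + r * 18) + c))))) ≡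
                        suc f * (20 + r * 18) + c
    arrange = solve-∀

  events≤ : ∀ m → events m ≤ 2 * m
  events≤ zero    = z≤n
  events≤ (suc m) = s≤s (ℕₚ.+-monoʳ-≤ m (ℕₚ.≤-trans (ℕₚ.n≤1+n m) (ℕₚ.≤-reflexive (sym (ℕₚ.+-identityʳ (suc m))))))

  -- Expanded, the left side is 87au + 189a + 23u + 1. No monomial exceeds au, and the coefficients
  -- add up to 300.
  polynomial-bound : ∀ {a u} → 0 < a → 0 < u →
    1 + (2 * a * (20 + (suc (u + 1) + suc (u + 1)) * 18) + (u * (23 + 15 * a) + a * 5)) ≤ 300 * (a * u)
  polynomial-bound {suc a} {suc u} _ _ =
    ℕₚ.≤-trans (ℕₚ.m≤m+n _ (24 * a + 190 * u + 213 * (a * u))) (ℕₚ.≤-reflexive (identity a u))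
    where
    identity : ∀ a u → 1 + (2 * suc a * (20 + (suc (suc u + 1) + suc (suc u + 1)) * 18) +
                         (suc u * (23 + 15 * suc a) + suc a * 5)) + (24 * a + 190 * u + 213 * (a * u))
                     ≡ 300 * (suc a * suc u)
    identity = solve-∀

  cost-bound : 0 < n → 0 < ⌈log₂ n ⌉ → 1 + cost₁ (events n) ≤ 300 * (n * (scale n * ⌈log₂ n ⌉))
  cost-bound 0<n 0<log = begin
    1 + cost₁ (events n)
      ≡⟨ cong suc (cost₁-closed (events n)) ⟩
    1 + (events n * (20 + (radius n + radius n) * 18) + cost₂ (fuel₂ n))
      ≡⟨ cong (λ c → 1 + (events n * (20 + (radius n + radius n) * 18) + c)) (cost₂-closed (fuel₂ n)) ⟩
    1 + (events n * (20 + (radius n + radius n) * 18) + (fuel₂ n * (23 + 15 * n) + n * 5))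
      ≤⟨ s≤s (ℕₚ.+-monoˡ-≤ _ (ℕₚ.*-monoˡ-≤ (20 + (radius n + radius n) * 18) (events≤ n))) ⟩
    1 + (2 * n * (20 + (radius n + radius n) * 18) + (fuel₂ n * (23 + 15 * n) + n * 5))
      ≡⟨ cong (λ u → 1 + (2 * n * (20 + (suc (u + 1) + suc (u + 1)) * 18) + (fuel₂ n * (23 + 15 * n) + n * 5)))
              (ℕₚ.*-comm ⌈log₂ n ⌉ (scale n)) ⟩
    1 + (2 * n * (20 + (suc (fuel₂ n + 1) + suc (fuel₂ n + 1)) * 18) + (fuel₂ n * (23 + 15 * n) + n * 5))
      ≤⟨ polynomial-bound 0<n (ℕₚ.*-mono-≤ {1} {scale n} (s≤s z≤n) 0<log) ⟩
    300 * (n * (scale n * ⌈log₂ n ⌉))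
      ∎
    where open ℕₚ.≤-Reasoning

  algorithm : Algorithm n
  algorithm = record { kv = 7 ; ke = 3 ; prog = main }

theorem2 : (p q : ℕ) → 0 < p → 2 * p ≤ q →
    ∃ λ (C : ℕ) → ∃ λ (N : ℕ) → ∃ λ (A : (n : ℕ) → Algorithm n) →
    (∀ n (M : MDP n) (ch : Chooser n) → ValidChooser ch →
    IsMECDecomposition M (outputs (execute (A n) M ch)))
    × (∀ n → N ≤ n →
    (space (A n) ^ q ≤ C ^ q * n ^ p * ⌈log₂ n ⌉ ^ q)
    × (∀ (M : MDP n) (ch : Chooser n) → ValidChooser ch →
    ops (execute (A n) M ch) ^ q
    ≤ C ^ q * n ^ (2 * q ∸ p) * ⌈log₂ n ⌉ ^ q))
-- 600 is twice 300, the factor 2 coming from D ≤ 2√n. From `n = 2` on the logarithm is positive; at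
-- `n = 1` it would make the bounds vanish.
theorem2 p q 0<p 2p≤q = 600 , 2 , MEC.algorithm , correct , λ n 2≤n → space-bound n 2≤n , ops-bound n 2≤n
  where
  correct : ∀ n (M : MDP n) (ch : Chooser n) → ValidChooser ch →
            IsMECDecomposition M (outputs (execute (MEC.algorithm n) M ch))
  correct n M ch valid =
    Semantics.Sat.holds {R = replicate 7 ⊥} {Q = replicate 3 (replicate n ⊥)}
      (Semantics.sat-main M ch valid (scale n) (fuel₂ n) (fuel₂-enough n)) 0

  0<log : ∀ {n} → 2 ≤ n → 0 < ⌈log₂ n ⌉
  0<log = ⌈log₂⌉-mono-≤ {2}

  space-bound : ∀ n → 2 ≤ n → 10 ^ q ≤ 600 ^ q * n ^ p * ⌈log₂ n ⌉ ^ q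
  space-bound n 2≤n = begin
    10 ^ q                                 ≤⟨ ℕₚ.^-monoˡ-≤ q (ℕₚ.m≤m+n 10 590) ⟩
    600 ^ q                                ≤⟨ ℕₚ.m≤m*n (600 ^ q) (n ^ p) {{ℕₚ.m^n≢0 n p {{>-nonZero (ℕₚ.<⇒≤ 2≤n)}}}} ⟩
    600 ^ q * n ^ p                        ≤⟨ ℕₚ.m≤m*n _ (⌈log₂ n ⌉ ^ q) {{ℕₚ.m^n≢0 ⌈log₂ n ⌉ q {{>-nonZero (0<log 2≤n)}}}} ⟩
    600 ^ q * n ^ p * ⌈log₂ n ⌉ ^ q        ∎
    where open ℕₚ.≤-Reasoning

  ops-bound : ∀ n → 2 ≤ n → ∀ (M : MDP n) (ch : Chooser n) → ValidChooser ch →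
              ops (execute (MEC.algorithm n) M ch) ^ q ≤ 600 ^ q * n ^ (2 * q ∸ p) * ⌈log₂ n ⌉ ^ q
  ops-bound n 2≤n M ch _ = power-bound {p} {q} {n} {scale n} 300 2p≤q 0<n (scale²≤4n 0<n)
    (ℕₚ.≤-trans (cost-sound (MEC.main n) (MEC.cost-main n) M ch
        (replicate 7 ⊥) (replicate 3 (replicate n ⊥)) 0)
      (ℕₚ.≤-trans (ℕₚ.≤-reflexive (ℕₚ.+-identityʳ _)) (MEC.cost-bound n 0<n (0<log 2≤n))))
    where
    0<n : 0 < n
    0<n = ℕₚ.<⇒≤ 2≤n
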